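{- As formal power series, $$A(t,x,y)=\frac{(t-1)\,xy\,e^{(t-1)xy}}{t-e^{(t-1)x(1+y)}}.$$
   Context: For $n\ge1$, $0\le d\le n-1$, $1\le j\le n$, $A(n,d,j)$ is the number of permutations $\pi_1\cdots\pi_n$ of $\{1,\dots,n\}$ with exactly $d$ descents (positions $i\in\{1,\dots,n-1\}$ with $\pi_i>\pi_{i+1}$) and first letter $\pi_1=j$; $A(n,d,j)=0$ for all other $n,d,j$. Define $$A(t,x,y)=\sum_{n\ge1}\sum_{d\ge0}\sum_{j=1}^{n}\frac{A(n,d,j)\,t^dx^ny^j}{(j-1)!\,(n-j)!}.$$ The right-hand side of the identity is expanded as a power series in $x,y$ with coefficients in $\mathbb Q(t)$. -}

module Defs where

open import Level using (Level; 0ℓ)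
open import Algebra.Bundles using (RawRing)
import Algebra.Definitions.RawSemiring as RawSemiringDefs
open import Data.Bool.Base using (if_then_else_)
open import Data.Empty using (⊥-elim)
open import Data.Fin.Base as Fin using (Fin; toℕ)
import Data.Fin.Properties as Fin
open import Data.Integer.Base using (+_)
open import Data.List.Base as List using (List; []; _∷_)
open import Data.Nat.Base as ℕ using (ℕ; zero; suc; _∸_; _!)
import Data.Nat.Properties as ℕ
open import Data.Product.Base using (_×_; _,_)
open import Data.Rational.Base as ℚ using (ℚ; 0ℚ; 1ℚ)
import Data.Rational.Properties as ℚ
open import Data.Sum.Base using (_⊎_; inj₁; inj₂; [_,_]′)
open import Data.Vec.Base as Vec using (Vec; []; _∷_)
import Data.Vec.Relation.Unary.AllPairs as AllPairs
open import Data.Vec.Relation.Unary.Unique.Propositional using (Unique)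
open import Relation.Binary.PropositionalEquality
  using (_≡_; refl; sym; trans; cong; cong₂; module ≡-Reasoning)
open import Relation.Nullary using (¬_; does; yes; no)
open import Relation.Nullary.Decidable using (¬?; _×-dec_)
open import Relation.Unary using (Decidable)

private
  variable
    m n : ℕ

-- The element i of Fin n stands for the letter toℕ i + 1.

words : ∀ n m → List (Vec (Fin n) m)
words n zero    = [] ∷ []
words n (suc m) = List.cartesianProductWith _∷_ (List.allFin n) (words n m)

des : Vec (Fin n) m → ℕ
des []          = 0
des (_ ∷ [])    = 0
des (a ∷ b ∷ w) = (if does (b Fin.<? a) then 1 else 0) ℕ.+ des (b ∷ w)

firstLetter : Vec (Fin n) (suc m) → ℕ
firstLetter π = suc (toℕ (Vec.head π))

-- A word of length n with distinct letters among n is a permutation.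

IsCounted : ∀ d j → Vec (Fin (suc n)) (suc n) → Set
IsCounted d j π = Unique π × des π ≡ d × firstLetter π ≡ j

isCounted? : ∀ d j → Decidable (IsCounted {n} d j)
isCounted? d j π =
  AllPairs.allPairs? (λ a b → ¬? (a Fin.≟ b)) π
    ×-dec (des π ℕ.≟ d) ×-dec (firstLetter π ℕ.≟ j)

A : (n d j : ℕ) → ℕ
A zero    d j = 0
A (suc n) d j = List.length (List.filter (isCounted? d j) (words (suc n) (suc n)))

-- Coefficient lists, constant term first.  Trailing zeros are allowed, so
-- polynomials are compared coefficientwise.

ℚ[t] : Set
ℚ[t] = List ℚ

coeff : ℚ[t] → ℕ → ℚ
coeff []      _       = 0ℚ
coeff (c ∷ p) zero    = c
coeff (c ∷ p) (suc k) = coeff p k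

infix 4 _≈ₚ_ _≉ₚ_
_≈ₚ_ _≉ₚ_ : ℚ[t] → ℚ[t] → Set
p ≈ₚ q = ∀ k → coeff p k ≡ coeff q k
p ≉ₚ q = ¬ (p ≈ₚ q)

0ₚ 1ₚ : ℚ[t]
0ₚ = []
1ₚ = 1ℚ ∷ []

infixl 6 _+ₚ_
_+ₚ_ : ℚ[t] → ℚ[t] → ℚ[t]
[]      +ₚ q       = q
(c ∷ p) +ₚ []      = c ∷ p
(c ∷ p) +ₚ (d ∷ q) = (c ℚ.+ d) ∷ (p +ₚ q)

-ₚ_ : ℚ[t] → ℚ[t]
-ₚ p = List.map ℚ.-_ p

infixl 7 _*ₚ_
_*ₚ_ : ℚ[t] → ℚ[t] → ℚ[t]
[]      *ₚ q = []
(c ∷ p) *ₚ q = List.map (c ℚ.*_) q +ₚ (0ℚ ∷ p *ₚ q)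

-- ℚ[t] is an integral domain; this makes the fraction field below
-- well defined.

coeff-+ : ∀ p q k → coeff (p +ₚ q) k ≡ coeff p k ℚ.+ coeff q k
coeff-+ []      q       k       = sym (ℚ.+-identityˡ _)
coeff-+ (c ∷ p) []      k       = sym (ℚ.+-identityʳ _)
coeff-+ (c ∷ p) (d ∷ q) zero    = refl
coeff-+ (c ∷ p) (d ∷ q) (suc k) = coeff-+ p q k

coeff-scale : ∀ c p k → coeff (List.map (c ℚ.*_) p) k ≡ c ℚ.* coeff p k
coeff-scale c []      k       = sym (ℚ.*-zeroʳ c)
coeff-scale c (d ∷ p) zero    = refl
coeff-scale c (d ∷ p) (suc k) = coeff-scale c p k

coeff-*-zero : ∀ c p q → coeff ((c ∷ p) *ₚ q) 0 ≡ c ℚ.* coeff q 0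
coeff-*-zero c p q = begin
  coeff ((c ∷ p) *ₚ q) 0                     ≡⟨ coeff-+ (List.map (c ℚ.*_) q) (0ℚ ∷ p *ₚ q) 0 ⟩
  coeff (List.map (c ℚ.*_) q) 0 ℚ.+ 0ℚ       ≡⟨ ℚ.+-identityʳ _ ⟩
  coeff (List.map (c ℚ.*_) q) 0              ≡⟨ coeff-scale c q 0 ⟩
  c ℚ.* coeff q 0                            ∎
  where open ≡-Reasoning

coeff-*-suc : ∀ c p q k →
  coeff ((c ∷ p) *ₚ q) (suc k) ≡ c ℚ.* coeff q (suc k) ℚ.+ coeff (p *ₚ q) k
coeff-*-suc c p q k =
  trans (coeff-+ (List.map (c ℚ.*_) q) (0ℚ ∷ p *ₚ q) (suc k))
        (cong (ℚ._+ coeff (p *ₚ q) k) (coeff-scale c q (suc k)))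

shift-zero : ∀ p q → coeff (p *ₚ (0ℚ ∷ q)) 0 ≡ 0ℚ
shift-zero []      q = refl
shift-zero (c ∷ p) q = trans (coeff-*-zero c p (0ℚ ∷ q)) (ℚ.*-zeroʳ c)

shift-suc : ∀ p q k → coeff (p *ₚ (0ℚ ∷ q)) (suc k) ≡ coeff (p *ₚ q) k
shift-suc []      q k       = refl
shift-suc (c ∷ p) q zero    = begin
  coeff ((c ∷ p) *ₚ (0ℚ ∷ q)) 1                        ≡⟨ coeff-*-suc c p (0ℚ ∷ q) 0 ⟩
  c ℚ.* coeff q 0 ℚ.+ coeff (p *ₚ (0ℚ ∷ q)) 0          ≡⟨ cong (c ℚ.* coeff q 0 ℚ.+_) (shift-zero p q) ⟩
  c ℚ.* coeff q 0 ℚ.+ 0ℚ                               ≡⟨ ℚ.+-identityʳ _ ⟩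
  c ℚ.* coeff q 0                                      ≡⟨ coeff-*-zero c p q ⟨
  coeff ((c ∷ p) *ₚ q) 0                               ∎
  where open ≡-Reasoning
shift-suc (c ∷ p) q (suc k) = begin
  coeff ((c ∷ p) *ₚ (0ℚ ∷ q)) (suc (suc k))            ≡⟨ coeff-*-suc c p (0ℚ ∷ q) (suc k) ⟩
  c ℚ.* coeff q (suc k) ℚ.+ coeff (p *ₚ (0ℚ ∷ q)) (suc k) ≡⟨ cong (c ℚ.* coeff q (suc k) ℚ.+_) (shift-suc p q k) ⟩
  c ℚ.* coeff q (suc k) ℚ.+ coeff (p *ₚ q) k           ≡⟨ coeff-*-suc c p q k ⟨
  coeff ((c ∷ p) *ₚ q) (suc k)                         ∎
  where open ≡-Reasoning

c*d≡0⇒d≡0 : ∀ c d → ¬ (c ≡ 0ℚ) → c ℚ.* d ≡ 0ℚ → d ≡ 0ℚ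
c*d≡0⇒d≡0 c d c≢0 cd≡0 = begin
  d                              ≡⟨ ℚ.*-identityˡ d ⟨
  1ℚ ℚ.* d                       ≡⟨ cong (ℚ._* d) (ℚ.*-inverseˡ c) ⟨
  (ℚ.1/ c) ℚ.* c ℚ.* d           ≡⟨ ℚ.*-assoc (ℚ.1/ c) c d ⟩
  (ℚ.1/ c) ℚ.* (c ℚ.* d)         ≡⟨ cong ((ℚ.1/ c) ℚ.*_) cd≡0 ⟩
  (ℚ.1/ c) ℚ.* 0ℚ                ≡⟨ ℚ.*-zeroʳ (ℚ.1/ c) ⟩
  0ℚ                             ∎
  where
  open ≡-Reasoning
  instance _ = ℚ.≢-nonZero c≢0

c≢0⇒q≈0 : ∀ c p q → ¬ (c ≡ 0ℚ) → (c ∷ p) *ₚ q ≈ₚ 0ₚ → q ≈ₚ 0ₚ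
c≢0⇒q≈0 c p []      c≢0 eq k = refl
c≢0⇒q≈0 c p (d ∷ q) c≢0 eq k
  with refl ← c*d≡0⇒d≡0 c d c≢0 (trans (sym (coeff-*-zero c p (d ∷ q))) (eq 0))
  = lemma k
  where
  lemma : d ∷ q ≈ₚ 0ₚ
  lemma zero    = refl
  lemma (suc k) =
    c≢0⇒q≈0 c p q c≢0 (λ i → trans (sym (shift-suc (c ∷ p) q i)) (eq (suc i))) k

*ₚ-noZeroDivisors : ∀ p q → p *ₚ q ≈ₚ 0ₚ → p ≈ₚ 0ₚ ⊎ q ≈ₚ 0ₚ
*ₚ-noZeroDivisors []      q eq = inj₁ λ _ → refl
*ₚ-noZeroDivisors (c ∷ p) q eq with c ℚ.≟ 0ℚ
... | no c≢0   = inj₂ (c≢0⇒q≈0 c p q c≢0 eq)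
... | yes refl with *ₚ-noZeroDivisors p q tail≈0
  where
  open ≡-Reasoning
  tail≈0 : p *ₚ q ≈ₚ 0ₚ
  tail≈0 k = begin
    coeff (p *ₚ q) k                                  ≡⟨ ℚ.+-identityˡ _ ⟨
    0ℚ ℚ.+ coeff (p *ₚ q) k                           ≡⟨ cong (ℚ._+ coeff (p *ₚ q) k) (ℚ.*-zeroˡ (coeff q (suc k))) ⟨
    0ℚ ℚ.* coeff q (suc k) ℚ.+ coeff (p *ₚ q) k       ≡⟨ coeff-*-suc 0ℚ p q k ⟨
    coeff ((0ℚ ∷ p) *ₚ q) (suc k)                     ≡⟨ eq (suc k) ⟩
    0ℚ                                                ∎
... | inj₁ p≈0 = inj₁ λ { zero → refl ; (suc k) → p≈0 k }
... | inj₂ q≈0 = inj₂ q≈0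

*ₚ-≉0 : ∀ p q → p ≉ₚ 0ₚ → q ≉ₚ 0ₚ → p *ₚ q ≉ₚ 0ₚ
*ₚ-≉0 p q p≉0 q≉0 eq = [ p≉0 , q≉0 ]′ (*ₚ-noZeroDivisors p q eq)

1ₚ≉0ₚ : 1ₚ ≉ₚ 0ₚ
1ₚ≉0ₚ eq = ℚ.1≢0 (eq 0)

infix 6 _//_⟨_⟩
record ℚ⟨t⟩ : Set where
  constructor _//_⟨_⟩
  field
    num   : ℚ[t]
    den   : ℚ[t]
    den≉0 : den ≉ₚ 0ₚ

fromPoly : ℚ[t] → ℚ⟨t⟩
fromPoly p = p // 1ₚ ⟨ 1ₚ≉0ₚ ⟩

ℚ⟨t⟩-rawRing : RawRing 0ℓ 0ℓ
ℚ⟨t⟩-rawRing = record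
  { Carrier = ℚ⟨t⟩
  ; _≈_ = λ { (p // q ⟨ _ ⟩) (r // s ⟨ _ ⟩) → p *ₚ s ≈ₚ r *ₚ q }
  ; _+_ = λ { (p // q ⟨ q≉0 ⟩) (r // s ⟨ s≉0 ⟩) →
              (p *ₚ s +ₚ r *ₚ q) // q *ₚ s ⟨ *ₚ-≉0 q s q≉0 s≉0 ⟩ }
  ; _*_ = λ { (p // q ⟨ q≉0 ⟩) (r // s ⟨ s≉0 ⟩) →
              (p *ₚ r) // q *ₚ s ⟨ *ₚ-≉0 q s q≉0 s≉0 ⟩ }
  ; -_  = λ { (p // q ⟨ q≉0 ⟩) → (-ₚ p) // q ⟨ q≉0 ⟩ }
  ; 0#  = fromPoly 0ₚ
  ; 1#  = fromPoly 1ₚ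
  }

module K where
  open RawRing ℚ⟨t⟩-rawRing public
  open RawSemiringDefs (RawRing.rawSemiring ℚ⟨t⟩-rawRing) public using (sum; _^_)

ι : ℚ → ℚ⟨t⟩
ι c = fromPoly (c ∷ [])

t : ℚ⟨t⟩
t = fromPoly (0ℚ ∷ 1ℚ ∷ [])

num≉0 : ∀ f → f K.≉ K.0# → ℚ⟨t⟩.num f ≉ₚ 0ₚ
num≉0 (p // q ⟨ _ ⟩) f≉0 p≈0 = f≉0 λ k → p*1≈0 p p≈0 k
  where
  p*1≈0 : ∀ p → p ≈ₚ 0ₚ → p *ₚ 1ₚ ≈ₚ 0ₚ
  p*1≈0 []      p≈0 k       = refl
  p*1≈0 (c ∷ p) p≈0 zero    =
    trans (coeff-*-zero c p 1ₚ) (trans (ℚ.*-identityʳ c) (p≈0 0))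
  p*1≈0 (c ∷ p) p≈0 (suc k) =
    trans (coeff-*-suc c p 1ₚ k)
          (cong₂ ℚ._+_ (ℚ.*-zeroʳ c) (p*1≈0 p (λ i → p≈0 (suc i)) k))

inv : (f : ℚ⟨t⟩) → f K.≉ K.0# → ℚ⟨t⟩
inv f@(p // q ⟨ _ ⟩) f≉0 = q // p ⟨ num≉0 f f≉0 ⟩

module PowerSeries {c ℓ : Level} (R : RawRing c ℓ) where

  private
    module R where
      open RawRing R public
      open RawSemiringDefs (RawRing.rawSemiring R) public using (sum)

  -- f n j is the coefficient of xⁿyʲ.

  Series : Set c
  Series = ℕ → ℕ → R.Carrier

  infix  4 _≈ˢ_
  infixl 6 _+ˢ_ _-ˢ_
  infixl 7 _*ˢ_
  infix  8 -ˢ_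

  _≈ˢ_ : Series → Series → Set ℓ
  f ≈ˢ g = ∀ n j → f n j R.≈ g n j

  const : R.Carrier → Series
  const a zero zero = a
  const a _    _    = R.0#

  X Y : Series
  X 1 0 = R.1#
  X _ _ = R.0#
  Y 0 1 = R.1#
  Y _ _ = R.0#

  _+ˢ_ : Series → Series → Series
  (f +ˢ g) n j = f n j R.+ g n j

  -ˢ_ : Series → Series
  (-ˢ_ f) n j = R.- f n j

  _-ˢ_ : Series → Series → Series
  f -ˢ g = f +ˢ (-ˢ g)

  _*ˢ_ : Series → Series → Series
  (f *ˢ g) n j = R.sum {suc n} λ a → R.sum {suc j} λ b →
    f (toℕ a) (toℕ b) R.* g (n ∸ toℕ a) (j ∸ toℕ b)

  series-rawRing : RawRing c ℓ
  series-rawRing = record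
    { Carrier = Series
    ; _≈_ = _≈ˢ_
    ; _+_ = _+ˢ_
    ; _*_ = _*ˢ_
    ; -_  = -ˢ_
    ; 0#  = const R.0#
    ; 1#  = const R.1#
    }

  1ˢ : Series
  1ˢ = RawRing.1# series-rawRing

  open RawSemiringDefs (RawRing.rawSemiring series-rawRing) public
    using () renaming (_^_ to _^ˢ_)

  -- The composite Σₖ cₖ hᵏ, for h with zero constant term: hᵏ then has no
  -- terms of total degree below k, so only k ≤ n + j contribute to the
  -- coefficient of xⁿyʲ.

  compose : (ℕ → R.Carrier) → Series → Series
  compose c h n j = R.sum {suc (n ℕ.+ j)} λ k → c (toℕ k) R.* (h ^ˢ toℕ k) n j

open PowerSeries ℚ⟨t⟩-rawRing public

1/_! : ℕ → ℚ
1/ k ! = (+ 1 ℚ./ k !) {{k ℕ.!≢0}}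

-- Only meaningful for series with zero constant term.

exp : Series → Series
exp = compose (λ k → ι (1/ k !))

-- With a the constant term of g, 1/g = a⁻¹ Σₖ (1 - a⁻¹g)ᵏ; the series
-- 1 - a⁻¹g has zero constant term.

infixl 7 _/ˢ_[_]
_/ˢ_[_] : (f g : Series) → g 0 0 K.≉ K.0# → Series
f /ˢ g [ g₀≉0 ] = f *ˢ (const a⁻¹ *ˢ compose (λ _ → K.1#) (1ˢ -ˢ const a⁻¹ *ˢ g))
  where a⁻¹ = inv (g 0 0) g₀≉0

T : Series
T = const t

-- The sum over d stops at d = n - 1 because A n d j = 0 for d ≥ n.

Aˢ : Series
Aˢ n j =
  if does ((1 ℕ.≤? j) ×-dec (j ℕ.≤? n))
  then (K.sum {n} λ d → ι (weight (toℕ d)) K.* t K.^ toℕ d)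
  else K.0#
  where
  weight : ℕ → ℚ
  weight d = (+ A n d j ℚ./ ((j ∸ 1) ! ℕ.* (n ∸ j) !)) {{(j ∸ 1) ℕ.!* (n ∸ j) !≢0}}

denominator : Series
denominator = T -ˢ exp ((T -ˢ 1ˢ) *ˢ X *ˢ (1ˢ +ˢ Y))

-- The constant term of the denominator is t - 1.

denominator₀≉0 : denominator 0 0 K.≉ K.0#
denominator₀≉0 eq with () ← eq 1

{-# OPTIONS --safe #-}

module Submission where

-- Write u = t - 1, and let F = A/(xy), whose coefficient of xⁿyʲ is
-- Bₙⱼ(t)/(j! (n-j)!), where Bₙⱼ(t) = Σ_d A(n+1,d,j+1) tᵈ.  Deleting the first letter
-- of a permutation gives Bₙ₊₁,ₚ = t Σ_{i<p} Bₙᵢ + Σ_{i≥p} Bₙᵢ, hence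
-- Bₙ₊₁,ₚ₊₁ = Bₙ₊₁,ₚ + u Bₙₚ and Bₙ₊₁,ₙ₊₁ = t Bₙ₊₁,₀.
--
-- The first of these relations says that F solves the transport equation
-- (1+y) ∂f/∂y = x ∂f/∂x + u x f.  The exponential E₂ = e^{uxy} solves it too, and
-- E₁ = e^{ux(1+y)} solves the homogeneous one, so t F and F E₁ + u E₂ are both
-- solutions.  A solution is determined by its coefficients at y⁰.  There, the first
-- relation identifies the coefficients of F E₁ with those of F on the diagonal, and
-- the second relation then gives equality.  So F (t - E₁) = u E₂.

open import Level using (Level; 0ℓ; _⊔_)
open import Algebra.Bundles using (CommutativeRing; RawRing; Ring; Semiring)
open import Algebra.Structures using (IsCommutativeRing)
open import Algebra.Morphism.Structures using (IsRingMonomorphism)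
import Algebra.Definitions.RawSemiring as RawSemiringDefs
import Algebra.Morphism.RingMonomorphism as RingMonomorphism
import Algebra.Properties.CommutativeSemigroup as CommutativeSemigroupProperties
import Algebra.Properties.Ring as RingProperties
import Algebra.Properties.Semiring.Mult as SemiringMult
import Algebra.Properties.Semiring.Sum as SemiringSum
import Algebra.Solver.Ring.NaturalCoefficients.Default as RingSolver
open import Data.Bool.Base as Bool using (Bool; true; false; if_then_else_; not; _∧_)
open import Data.Fin.Base as Fin using (Fin; zero; suc; toℕ; punchIn)
import Data.Fin.Properties as Fin
open import Data.Integer.Base as ℤ using (+_)
import Data.Integer.Properties as ℤ
open import Data.List.Base as List using (List; []; _∷_; _++_)
open import Data.Nat.Base as ℕ using (ℕ; zero; suc; _∸_; _!; _≡ᵇ_; _<ᵇ_; z≤n; s≤s)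
import Data.Nat.Properties as ℕ
open import Data.Product.Base using (_,_)
open import Data.Rational.Base as ℚ using (ℚ; 0ℚ; 1ℚ; fromℚᵘ; toℚᵘ)
import Data.Rational.Properties as ℚ
open import Data.Rational.Unnormalised.Base as ℚᵘ using (mkℚᵘ; *≡*)
import Data.Rational.Unnormalised.Properties as ℚᵘ
open import Data.Sum.Base using (_⊎_; inj₁; inj₂)
open import Data.Unit.Base using (tt)
open import Data.Vec.Base as Vec using (Vec; []; _∷_)
import Data.Vec.Relation.Unary.All as All
import Data.Vec.Relation.Unary.AllPairs as AllPairs
open import Function.Base using (_∘_; id)
open import Relation.Binary.PropositionalEquality as ≡ using (_≡_)
import Relation.Binary.Reasoning.Setoid as SetoidReasoning
open import Relation.Nullary using (does; contradiction)
open import Relation.Nullary.Decidable using (¬?)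
open import Relation.Unary using (Decidable; Pred)

open import Defs using (module PowerSeries; words; des; firstLetter; isCounted?; A)

-- The formula has the shape of a solution along characteristics: a solution of the transport
-- equation is e^(uxy) times a function of x(1+y), and the theorem says that for F this function is
-- u/(t - E₁). Comparing `T *ˢ F` with `F *ˢ E₁ +ˢ U *ˢ E₂` expresses this without division and
-- leaves only y = 0 to check.
--
-- Two obstacles shape the proof. Elements of ℚ(t) are unreduced fractions of coefficient lists,
-- equal up to cross multiplication, and a definitional comparison of closed series over them
-- computes coefficients. So the argument runs over an arbitrary commutative ring with an element t
-- and reciprocals of factorials, and ℚ(t) is substituted at the end. Moreover `compose` takes a
-- number of powers that depends on the coefficient asked for, so an exponential is not a sum in the
-- ring of series; derivations reach it through partial sums that agree with it up to a given total
-- degree.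

module FiniteSum {c ℓ : Level} (R : CommutativeRing c ℓ) where

  open CommutativeRing R
  open SemiringSum semiring
  open SemiringMult semiring renaming (_×_ to _·_)
  open SetoidReasoning setoid

  -- The summands are explicit because Agda cannot recover them from a sum over
  -- Fin (suc n), which unfolds.

  sum-cong : ∀ n (f g : Fin n → Carrier) → (∀ i → f i ≈ g i) → sum f ≈ sum g
  sum-cong n f g f≈g = sum-cong-≋ f≈g

  sum-+ : ∀ n (f g : Fin n → Carrier) → sum (λ i → f i + g i) ≈ sum f + sum g
  sum-+ n f g = ∑-distrib-+ f g

  sum-*ˡ : ∀ n a (f : Fin n → Carrier) → sum (λ i → a * f i) ≈ a * sum f
  sum-*ˡ n a f = sym (*-distribˡ-sum a f)

  sum-*ʳ : ∀ n a (f : Fin n → Carrier) → sum (λ i → f i * a) ≈ sum f * a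
  sum-*ʳ n a f = sym (*-distribʳ-sum a f)

  sum-zero : ∀ n (f : Fin n → Carrier) → (∀ i → f i ≈ 0#) → sum f ≈ 0#
  sum-zero n f f≈0 = trans (sum-cong-≋ f≈0) (sum-replicate-zero n)

  ·-as-* : ∀ n x → n · x ≈ (n · 1#) * x
  ·-as-* n x = sym (trans (×-assoc-* n 1# x) (×-congʳ n (*-identityˡ x)))

  sum-· : ∀ m n (f : Fin m → Carrier) → sum (λ i → n · f i) ≈ n · sum f
  sum-· m n f = begin
    sum (λ i → n · f i)         ≈⟨ sum-cong m _ _ (λ i → ·-as-* n (f i)) ⟩
    sum (λ i → (n · 1#) * f i)  ≈⟨ sum-*ˡ m (n · 1#) f ⟩
    (n · 1#) * sum f            ≈⟨ ·-as-* n (sum f) ⟨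
    n · sum f                   ∎

  -- The equation is asked for only where the test succeeds, because `sum-A` needs p ≤ n, which the
  -- range test in `Aˢ` supplies.
  if-cong : ∀ b x y → (b ≡ true → x ≈ y) → (if b then x else 0#) ≈ (if b then y else 0#)
  if-cong true  x y x≈y = x≈y ≡.refl
  if-cong false x y x≈y = refl

  -- For taking the common factor 1/((j-1)! (n-j)!) out of the sum over d; `a` will be the numbers
  -- of permutations and `x` the powers of t.
  sum-scale : ∀ n s (a : Fin n → ℕ) (w x : Fin n → Carrier) → (∀ i → w i ≈ a i · s) →
    sum (λ i → w i * x i) ≈ s * sum (λ i → a i · x i)
  sum-scale n s a w x w≈as = trans (sum-cong n _ _ term) (sum-*ˡ n s (λ i → a i · x i))
    where
    term : ∀ i → w i * x i ≈ s * (a i · x i)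
    term i = begin
      w i * x i            ≈⟨ *-congʳ (w≈as i) ⟩
      (a i · s) * x i      ≈⟨ ×-assoc-* (a i) s (x i) ⟩
      a i · (s * x i)      ≈⟨ ×-comm-* (a i) s (x i) ⟨
      s * (a i · x i)      ∎

-- Formal power series in one variable

module Convolution {c ℓ : Level} (R : CommutativeRing c ℓ) where

  open CommutativeRing R
  open SemiringSum semiring using (sum)
  open SemiringMult semiring renaming (_×_ to _·_)
  open FiniteSum R
  open RingSolver commutativeSemiring using (solve; _:=_; _:+_; _:*_; con)
  open SetoidReasoning setoid

  Seq : Set c
  Seq = ℕ → Carrier

  shift : Seq → Seq
  shift f n = f (suc n)

  infix 4 _≋_
  _≋_ : Seq → Seq → Set ℓ
  f ≋ g = ∀ n → f n ≈ g n

  infixl 6 _⊕_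
  _⊕_ : Seq → Seq → Seq
  (f ⊕ g) n = f n + g n

  infixl 7 _⊛_
  _⊛_ : Seq → Seq → Seq
  (f ⊛ g) n = sum {suc n} λ a → f (toℕ a) * g (n ∸ toℕ a)

  constant : Carrier → Seq
  constant a zero    = a
  constant a (suc _) = 0#

  var : Seq
  var 0             = 0#
  var 1             = 1#
  var (suc (suc _)) = 0#

  ⊛-cong : ∀ {f f′ g g′} → f ≋ f′ → g ≋ g′ → f ⊛ g ≋ f′ ⊛ g′
  ⊛-cong f≋ g≋ n = sum-cong (suc n) _ _ λ a → *-cong (f≋ (toℕ a)) (g≋ (n ∸ toℕ a))

  ⊛-zeroˡ : ∀ f g → (∀ n → f n ≈ 0#) → ∀ n → (f ⊛ g) n ≈ 0#
  ⊛-zeroˡ f g f≈0 n = sum-zero (suc n) _ λ a → trans (*-congʳ (f≈0 (toℕ a))) (zeroˡ (g (n ∸ toℕ a)))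

  ⊛-distribʳ : ∀ h f g → (f ⊕ g) ⊛ h ≋ (f ⊛ h) ⊕ (g ⊛ h)
  ⊛-distribʳ h f g n =
    trans (sum-cong (suc n) _ _ λ a → distribʳ (h (n ∸ toℕ a)) (f (toℕ a)) (g (toℕ a)))
          (sum-+ (suc n) (λ a → f (toℕ a) * h (n ∸ toℕ a)) (λ a → g (toℕ a) * h (n ∸ toℕ a)))

  ⊛-scaleˡ : ∀ a f g → (λ n → a * f n) ⊛ g ≋ (λ n → a * (f ⊛ g) n)
  ⊛-scaleˡ a f g n =
    trans (sum-cong (suc n) _ _ λ i → *-assoc a (f (toℕ i)) (g (n ∸ toℕ i)))
          (sum-*ˡ (suc n) a (λ i → f (toℕ i) * g (n ∸ toℕ i)))

  -- A convolution unfolds at its first term; this peels off the last one, so that commutativity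
  -- becomes an induction instead of a reversal of the summation.
  ⊛-suc : ∀ f g n → (f ⊛ g) (suc n) ≈ (f ⊛ shift g) n + f (suc n) * g 0
  ⊛-suc f g zero    =
    solve 4 (λ a b c d → a :* b :+ (c :* d :+ con 0) := a :* b :+ con 0 :+ c :* d)
      refl (f 0) (g 1) (f 1) (g 0)
  ⊛-suc f g (suc n) = begin
    f 0 * g (suc (suc n)) + (shift f ⊛ g) (suc n)
      ≈⟨ +-congˡ (⊛-suc (shift f) g n) ⟩
    f 0 * g (suc (suc n)) + ((shift f ⊛ shift g) n + f (suc (suc n)) * g 0)
      ≈⟨ +-assoc _ _ _ ⟨
    f 0 * g (suc (suc n)) + (shift f ⊛ shift g) n + f (suc (suc n)) * g 0
      ∎

  ⊛-comm : ∀ f g → f ⊛ g ≋ g ⊛ f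
  ⊛-comm f g zero    = +-congʳ (*-comm (f 0) (g 0))
  ⊛-comm f g (suc n) = begin
    f 0 * g (suc n) + (shift f ⊛ g) n  ≈⟨ +-cong (*-comm _ _) (⊛-comm (shift f) g n) ⟩
    g (suc n) * f 0 + (g ⊛ shift f) n  ≈⟨ +-comm _ _ ⟩
    (g ⊛ shift f) n + g (suc n) * f 0  ≈⟨ ⊛-suc g f n ⟨
    (g ⊛ f) (suc n)                    ∎

  -- Splitting off `f 0` leaves `shift f`, so scaling, distributivity and induction suffice and no
  -- double sum is reindexed.
  ⊛-assoc : ∀ f g h → (f ⊛ g) ⊛ h ≋ f ⊛ (g ⊛ h)
  ⊛-assoc f g h zero    =
    solve 3 (λ a b c → (a :* b :+ con 0) :* c :+ con 0 := a :* (b :* c :+ con 0) :+ con 0)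
      refl (f 0) (g 0) (h 0)
  ⊛-assoc f g h (suc n) = begin
    (f 0 * g 0 + 0#) * h (suc n) + (((λ m → f 0 * g (suc m)) ⊕ (shift f ⊛ g)) ⊛ h) n
      ≈⟨ +-congˡ (⊛-distribʳ h (λ m → f 0 * g (suc m)) (shift f ⊛ g) n) ⟩
    (f 0 * g 0 + 0#) * h (suc n) + (((λ m → f 0 * g (suc m)) ⊛ h) n + ((shift f ⊛ g) ⊛ h) n)
      ≈⟨ +-congˡ (+-cong (⊛-scaleˡ (f 0) (shift g) h n) (⊛-assoc (shift f) g h n)) ⟩
    (f 0 * g 0 + 0#) * h (suc n) + (f 0 * (shift g ⊛ h) n + (shift f ⊛ (g ⊛ h)) n)
      ≈⟨ solve 5 (λ a b c d e → (a :* b :+ con 0) :* c :+ (a :* d :+ e) := a :* (b :* c :+ d) :+ e)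
           refl (f 0) (g 0) (h (suc n)) ((shift g ⊛ h) n) ((shift f ⊛ (g ⊛ h)) n) ⟩
    f 0 * (g 0 * h (suc n) + (shift g ⊛ h) n) + (shift f ⊛ (g ⊛ h)) n
      ∎

  constant-⊛ : ∀ a f n → (constant a ⊛ f) n ≈ a * f n
  constant-⊛ a f zero    = +-identityʳ _
  constant-⊛ a f (suc n) =
    trans (+-congˡ (⊛-zeroˡ (shift (constant a)) f (λ _ → refl) n)) (+-identityʳ _)

  var-⊛-zero : ∀ f → (var ⊛ f) 0 ≈ 0#
  var-⊛-zero f = trans (+-identityʳ _) (zeroˡ _)

  var-⊛-suc : ∀ f n → (var ⊛ f) (suc n) ≈ f n
  var-⊛-suc f n = begin
    0# * f (suc n) + (shift var ⊛ f) n  ≈⟨ +-cong (zeroˡ _) (⊛-cong {g = f} shift-var (λ _ → refl) n) ⟩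
    0# + (constant 1# ⊛ f) n            ≈⟨ +-identityˡ _ ⟩
    (constant 1# ⊛ f) n                 ≈⟨ constant-⊛ 1# f n ⟩
    1# * f n                            ≈⟨ *-identityˡ _ ⟩
    f n                                 ∎
    where
    shift-var : shift var ≋ constant 1#
    shift-var zero    = refl
    shift-var (suc n) = refl

  ⊛-identityˡ : ∀ f → constant 1# ⊛ f ≋ f
  ⊛-identityˡ f n = trans (constant-⊛ 1# f n) (*-identityˡ _)

  seq-rawRing : RawRing c ℓ
  seq-rawRing = record
    { Carrier = Seq
    ; _≈_     = _≋_
    ; _+_     = _⊕_
    ; _*_     = _⊛_
    ; -_      = λ f n → - f n
    ; 0#      = λ _ → 0#
    ; 1#      = constant 1#
    }

  -- Being a commutative ring again, it can itself serve as coefficient ring: series in x and y are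
  -- handled as series in x over series in y.
  seqRing : CommutativeRing c ℓ
  seqRing = record
    { RawRing seq-rawRing
    ; isCommutativeRing = record
      { isRing = record
        { +-isAbelianGroup = record
          { isGroup = record
            { isMonoid = record
              { isSemigroup = record
                { isMagma = record
                  { isEquivalence = record
                    { refl  = λ _ → refl
                    ; sym   = λ f≋g n → sym (f≋g n)
                    ; trans = λ f≋g g≋h n → trans (f≋g n) (g≋h n)
                    }
                  ; ∙-cong = λ f≋ g≋ n → +-cong (f≋ n) (g≋ n)
                  }
                ; assoc = λ f g h n → +-assoc (f n) (g n) (h n)
                }
              ; identity = (λ f n → +-identityˡ (f n)) , (λ f n → +-identityʳ (f n))
              }
            ; inverse = (λ f n → -‿inverseˡ (f n)) , (λ f n → -‿inverseʳ (f n))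
            ; ⁻¹-cong = λ f≋ n → -‿cong (f≋ n)
            }
          ; comm = λ f g n → +-comm (f n) (g n)
          }
        ; *-cong = ⊛-cong
        ; *-assoc = ⊛-assoc
        ; *-identity =
            ⊛-identityˡ , (λ f n → trans (⊛-comm f (constant 1#) n) (⊛-identityˡ f n))
        ; distrib = distribˡ′ , ⊛-distribʳ
        }
      ; *-comm = ⊛-comm
      }
    }
    where
    distribˡ′ : ∀ f g h → f ⊛ (g ⊕ h) ≋ (f ⊛ g) ⊕ (f ⊛ h)
    distribˡ′ f g h n = begin
      (f ⊛ (g ⊕ h)) n            ≈⟨ ⊛-comm f (g ⊕ h) n ⟩
      ((g ⊕ h) ⊛ f) n            ≈⟨ ⊛-distribʳ f g h n ⟩
      (g ⊛ f) n + (h ⊛ f) n      ≈⟨ +-cong (⊛-comm g f n) (⊛-comm h f n) ⟩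
      (f ⊛ g) n + (f ⊛ h) n      ∎

  ∂ : Seq → Seq
  ∂ f n = suc n · f (suc n)

  private
    θ : Seq → Seq
    θ f n = n · f n

    -- Termwise, the weight n splits as a + (n - a) between the two factors.
    θ-⊛ : ∀ f g → θ (f ⊛ g) ≋ θ f ⊛ g ⊕ f ⊛ θ g
    θ-⊛ f g n = begin
      n · sum terms              ≈⟨ sum-· (suc n) n terms ⟨
      sum (λ a → n · terms a)    ≈⟨ sum-cong (suc n) _ _ split ⟩
      sum {suc n} (λ a → θ f (toℕ a) * g (n ∸ toℕ a) + f (toℕ a) * θ g (n ∸ toℕ a))
        ≈⟨ sum-+ (suc n) (λ a → θ f (toℕ a) * g (n ∸ toℕ a)) (λ a → f (toℕ a) * θ g (n ∸ toℕ a)) ⟩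
      (θ f ⊛ g) n + (f ⊛ θ g) n  ∎
      where
      terms : Fin (suc n) → Carrier
      terms a = f (toℕ a) * g (n ∸ toℕ a)
      split : ∀ a → n · terms a ≈ θ f (toℕ a) * g (n ∸ toℕ a) + f (toℕ a) * θ g (n ∸ toℕ a)
      split a = begin
        n · terms a                                  ≡⟨ ≡.cong (_· terms a) (≡.sym (ℕ.m+[n∸m]≡n (Fin.toℕ≤pred[n] a))) ⟩
        (toℕ a ℕ.+ (n ∸ toℕ a)) · terms a            ≈⟨ ×-homo-+ _ (toℕ a) _ ⟩
        toℕ a · terms a + (n ∸ toℕ a) · terms a      ≈⟨ +-cong (×-assoc-* (toℕ a) _ _) (×-comm-* (n ∸ toℕ a) _ _) ⟨
        θ f (toℕ a) * g (n ∸ toℕ a) + f (toℕ a) * θ g (n ∸ toℕ a) ∎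

  -- Read off from s · d/ds, which acts diagonally on coefficients, in degree n + 1.
  ∂-⊛ : ∀ f g → ∂ (f ⊛ g) ≋ ∂ f ⊛ g ⊕ f ⊛ ∂ g
  ∂-⊛ f g n = begin
    θ (f ⊛ g) (suc n)
      ≈⟨ θ-⊛ f g (suc n) ⟩
    (0# * g (suc n) + (∂ f ⊛ g) n) + (f ⊛ θ g) (suc n)
      ≈⟨ +-cong (trans (+-congʳ (zeroˡ _)) (+-identityˡ _)) (⊛-suc f (θ g) n) ⟩
    (∂ f ⊛ g) n + ((f ⊛ ∂ g) n + f (suc n) * 0#)
      ≈⟨ +-congˡ (trans (+-congˡ (zeroʳ _)) (+-identityʳ _)) ⟩
    (∂ f ⊛ g) n + (f ⊛ ∂ g) n
      ∎

-- Derivations and the exponential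

record IsDerivation {c ℓ : Level} (R : CommutativeRing c ℓ)
  (D : CommutativeRing.Carrier R → CommutativeRing.Carrier R) : Set (c ⊔ ℓ) where
  open CommutativeRing R hiding (zero)
  field
    D-cong : ∀ x y → x ≈ y → D x ≈ D y
    D-+    : ∀ x y → D (x + y) ≈ D x + D y
    D-*    : ∀ x y → D (x * y) ≈ D x * y + x * D y
    D-0    : D 0# ≈ 0#
    D-1    : D 1# ≈ 0#

module Derivation {c ℓ : Level} (R : CommutativeRing c ℓ)
  (D : CommutativeRing.Carrier R → CommutativeRing.Carrier R) (isDerivation : IsDerivation R D) where

  open CommutativeRing R hiding (zero)
  open IsDerivation isDerivation
  open SemiringSum semiring using (sum)
  open SemiringMult semiring renaming (_×_ to _·_)
  open RawSemiringDefs (Semiring.rawSemiring semiring) using (_^_)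
  open FiniteSum R
  open SetoidReasoning setoid

  D-constant-* : ∀ a x → D a ≈ 0# → D (a * x) ≈ a * D x
  D-constant-* a x Da≈0 = begin
    D (a * x)            ≈⟨ D-* a x ⟩
    D a * x + a * D x    ≈⟨ +-congʳ (trans (*-congʳ Da≈0) (zeroˡ x)) ⟩
    0# + a * D x         ≈⟨ +-identityˡ _ ⟩
    a * D x              ∎

  D-^ : ∀ x k → D (x ^ suc k) ≈ suc k · (x ^ k * D x)
  D-^ x zero    = begin
    D (x * 1#)           ≈⟨ D-* x 1# ⟩
    D x * 1# + x * D 1#  ≈⟨ +-cong (*-comm (D x) 1#) (trans (*-congˡ D-1) (zeroʳ x)) ⟩
    1# * D x + 0#        ∎
  D-^ x (suc k) = begin
    D (x * x ^ suc k)                                ≈⟨ D-* x (x ^ suc k) ⟩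
    D x * x ^ suc k + x * D (x ^ suc k)              ≈⟨ +-cong (*-comm _ _) (*-congˡ (D-^ x k)) ⟩
    x ^ suc k * D x + x * (suc k · (x ^ k * D x))    ≈⟨ +-congˡ (×-comm-* (suc k) x (x ^ k * D x)) ⟩
    x ^ suc k * D x + suc k · (x * (x ^ k * D x))    ≈⟨ +-congˡ (×-congʳ (suc k) (*-assoc x (x ^ k) (D x))) ⟨
    x ^ suc k * D x + suc k · (x ^ suc k * D x)      ∎

  D-sum : ∀ n (f : Fin n → Carrier) → D (sum f) ≈ sum (D ∘ f)
  D-sum zero    f = D-0
  D-sum (suc n) f = trans (D-+ (f zero) _) (+-congˡ (D-sum n (f ∘ suc)))

  -- The recursion on `a` is that of 1/k!: it makes each differentiated term D x times the preceding
  -- term. Hence the rule for the exponential holds exactly for partial sums, with one term fewer on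
  -- the right.
  D-exponential : (a : ℕ → Carrier) → (∀ k → D (a k) ≈ 0#) → (∀ k → suc k · a (suc k) ≈ a k) → ∀ x N →
    D (sum {suc N} λ k → a (toℕ k) * x ^ toℕ k) ≈ sum {N} (λ k → a (toℕ k) * x ^ toℕ k) * D x
  D-exponential a Da≈0 a-suc x N = begin
    D (sum {suc N} λ k → a (toℕ k) * x ^ toℕ k)
      ≈⟨ D-sum (suc N) (λ k → a (toℕ k) * x ^ toℕ k) ⟩
    D (a 0 * 1#) + sum {N} (λ k → D (a (suc (toℕ k)) * x ^ suc (toℕ k)))
      ≈⟨ +-cong (trans (D-constant-* (a 0) 1# (Da≈0 0)) (trans (*-congˡ D-1) (zeroʳ _)))
                (sum-cong N _ _ λ k → step (toℕ k)) ⟩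
    0# + sum {N} (λ k → a (toℕ k) * x ^ toℕ k * D x)
      ≈⟨ +-identityˡ _ ⟩
    sum {N} (λ k → a (toℕ k) * x ^ toℕ k * D x)
      ≈⟨ sum-*ʳ N (D x) (λ k → a (toℕ k) * x ^ toℕ k) ⟩
    sum {N} (λ k → a (toℕ k) * x ^ toℕ k) * D x
      ∎
    where
    step : ∀ k → D (a (suc k) * x ^ suc k) ≈ a k * x ^ k * D x
    step k = begin
      D (a (suc k) * x ^ suc k)              ≈⟨ D-constant-* (a (suc k)) (x ^ suc k) (Da≈0 (suc k)) ⟩
      a (suc k) * D (x ^ suc k)              ≈⟨ *-congˡ (D-^ x k) ⟩
      a (suc k) * (suc k · (x ^ k * D x))    ≈⟨ ×-comm-* (suc k) _ _ ⟩
      suc k · (a (suc k) * (x ^ k * D x))    ≈⟨ ×-assoc-* (suc k) _ _ ⟨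
      (suc k · a (suc k)) * (x ^ k * D x)    ≈⟨ *-congʳ (a-suc k) ⟩
      a k * (x ^ k * D x)                    ≈⟨ *-assoc (a k) (x ^ k) (D x) ⟨
      a k * x ^ k * D x                      ∎

-- Quotients, without division in the ring

module Quotient {c ℓ : Level} (R : CommutativeRing c ℓ) where

  open CommutativeRing R hiding (zero)
  open RingProperties ring
  open RingSolver commutativeSemiring using (solve; _:=_; _:+_; _:*_; con)
  open SetoidReasoning setoid

  -- Models the division of series: `b` is the inverse of the constant term of g, and `s` the
  -- geometric series in 1 - bg. The fixpoint equation of `s` amounts to s · bg = 1, so bs inverts
  -- g.
  quotient-unique : ∀ a b f g s → s ≈ 1# + s * (1# + - (b * g)) → a * g ≈ f → a ≈ f * (b * s)
  quotient-unique a b f g s s≈1+sh ag≈f = begin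
    a                    ≈⟨ *-identityʳ a ⟨
    a * 1#               ≈⟨ *-congˡ 1≈sbg ⟩
    a * (s * (b * g))    ≈⟨ solve 4 (λ a s b g → a :* (s :* (b :* g)) := (a :* g) :* (b :* s)) refl a s b g ⟩
    (a * g) * (b * s)    ≈⟨ *-congʳ ag≈f ⟩
    f * (b * s)          ∎
    where
    1≈sbg : 1# ≈ s * (b * g)
    1≈sbg = +-cancelʳ (s * (1# + - (b * g))) 1# (s * (b * g)) (begin
      1# + s * (1# + - (b * g))                ≈⟨ s≈1+sh ⟨
      s                                        ≈⟨ *-identityʳ s ⟨
      s * 1#                                   ≈⟨ *-congˡ (+-identityʳ 1#) ⟨
      s * (1# + 0#)                            ≈⟨ *-congˡ (+-congˡ (-‿inverseʳ (b * g))) ⟨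
      s * (1# + (b * g + - (b * g)))           ≈⟨ solve 3 (λ s x y → s :* (con 1 :+ (x :+ y)) := s :* x :+ s :* (con 1 :+ y)) refl s (b * g) (- (b * g)) ⟩
      s * (b * g) + s * (1# + - (b * g))       ∎)

  *-difference : ∀ f t e g → t * f ≈ f * e + g → f * (t + - e) ≈ g
  *-difference f t e g tf≈fe+g = begin
    -- The solver works over semirings, so `- e` enters it as an atom.
    f * (t + - e)                 ≈⟨ solve 3 (λ f t e → f :* (t :+ e) := t :* f :+ f :* e) refl f t (- e) ⟩
    t * f + f * - e               ≈⟨ +-congʳ tf≈fe+g ⟩
    f * e + g + f * - e           ≈⟨ solve 4 (λ f e g d → f :* e :+ g :+ f :* d := f :* (e :+ d) :+ g) refl f e g (- e) ⟩
    f * (e + - e) + g             ≈⟨ +-congʳ (trans (*-congˡ (-‿inverseʳ e)) (zeroʳ f)) ⟩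
    0# + g                        ≈⟨ +-identityˡ g ⟩
    g                             ∎

  -- Carries the identity for F = A/(xy) over to A.
  shifted-* : ∀ a f d e x y u → a ≈ x * (y * f) → f * d ≈ u * e → a * d ≈ u * x * y * e
  shifted-* a f d e x y u a≈xyf fd≈ue = begin
    a * d                  ≈⟨ *-congʳ a≈xyf ⟩
    x * (y * f) * d        ≈⟨ solve 4 (λ x y f d → x :* (y :* f) :* d := x :* (y :* (f :* d))) refl x y f d ⟩
    x * (y * (f * d))      ≈⟨ *-congˡ (*-congˡ fd≈ue) ⟩
    x * (y * (u * e))      ≈⟨ solve 4 (λ x y u e → x :* (y :* (u :* e)) := u :* x :* y :* e) refl x y u e ⟩
    u * x * y * e          ∎

-- The transport equation

module Transport {c ℓ : Level} (R : CommutativeRing c ℓ)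
  (∂x ∂y : CommutativeRing.Carrier R → CommutativeRing.Carrier R)
  (∂x-isDerivation : IsDerivation R ∂x) (∂y-isDerivation : IsDerivation R ∂y)
  (X Y U : CommutativeRing.Carrier R) where

  open CommutativeRing R hiding (zero)
  private
    module Dx = IsDerivation ∂x-isDerivation
    module Dy = IsDerivation ∂y-isDerivation
  open Derivation R ∂x ∂x-isDerivation using () renaming (D-constant-* to ∂x-constant-*)
  open Derivation R ∂y ∂y-isDerivation using () renaming (D-constant-* to ∂y-constant-*)
  open RingSolver commutativeSemiring using (solve; _:=_; _:+_; _:*_; con)
  open SetoidReasoning setoid

  -- In the coordinates v = xy, z = x the first equation is ∂f/∂v - ∂f/∂z = u f,
  -- multiplied by x, and the second one ∂f/∂v = ∂f/∂z.
  Transported Invariant : Carrier → Set ℓ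
  Transported f = (1# + Y) * ∂y f ≈ X * ∂x f + (U * X) * f
  Invariant f = (1# + Y) * ∂y f ≈ X * ∂x f

  -- The equation is of first order, so the Leibniz rule distributes it over the factors; the
  -- zeroth-order term is contributed once, by f.
  transported-* : ∀ f g → Transported f → Invariant g → Transported (f * g)
  transported-* f g f-tr g-inv = begin
    (1# + Y) * ∂y (f * g)
      ≈⟨ *-congˡ (Dy.D-* f g) ⟩
    (1# + Y) * (∂y f * g + f * ∂y g)
      ≈⟨ solve 5 (λ a f′ g f g′ → a :* (f′ :* g :+ f :* g′) := (a :* f′) :* g :+ f :* (a :* g′)) refl (1# + Y) (∂y f) g f (∂y g) ⟩
    ((1# + Y) * ∂y f) * g + f * ((1# + Y) * ∂y g)
      ≈⟨ +-cong (*-congʳ f-tr) (*-congˡ g-inv) ⟩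
    (X * ∂x f + (U * X) * f) * g + f * (X * ∂x g)
      ≈⟨ solve 6 (λ x f′ w f g g′ → (x :* f′ :+ w :* f) :* g :+ f :* (x :* g′) := x :* (f′ :* g :+ f :* g′) :+ w :* (f :* g)) refl X (∂x f) (U * X) f g (∂x g) ⟩
    X * (∂x f * g + f * ∂x g) + (U * X) * (f * g)
      ≈⟨ +-congʳ (*-congˡ (Dx.D-* f g)) ⟨
    X * ∂x (f * g) + (U * X) * (f * g)
      ∎

  transported-constant-* : ∀ a f → ∂x a ≈ 0# → ∂y a ≈ 0# → Transported f → Transported (a * f)
  transported-constant-* a f ∂xa≈0 ∂ya≈0 f-tr = begin
    (1# + Y) * ∂y (a * f)                     ≈⟨ *-congˡ (∂y-constant-* a f ∂ya≈0) ⟩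
    (1# + Y) * (a * ∂y f)                     ≈⟨ solve 3 (λ y a f → y :* (a :* f) := a :* (y :* f)) refl (1# + Y) a (∂y f) ⟩
    a * ((1# + Y) * ∂y f)                     ≈⟨ *-congˡ f-tr ⟩
    a * (X * ∂x f + (U * X) * f)              ≈⟨ solve 5 (λ a x f′ w f → a :* (x :* f′ :+ w :* f) := x :* (a :* f′) :+ w :* (a :* f)) refl a X (∂x f) (U * X) f ⟩
    X * (a * ∂x f) + (U * X) * (a * f)        ≈⟨ +-congʳ (*-congˡ (∂x-constant-* a f ∂xa≈0)) ⟨
    X * ∂x (a * f) + (U * X) * (a * f)        ∎

  transported-+ : ∀ f g → Transported f → Transported g → Transported (f + g)
  transported-+ f g f-tr g-tr = begin
    (1# + Y) * ∂y (f + g)                                       ≈⟨ trans (*-congˡ (Dy.D-+ f g)) (distribˡ _ _ _) ⟩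
    (1# + Y) * ∂y f + (1# + Y) * ∂y g                           ≈⟨ +-cong f-tr g-tr ⟩
    (X * ∂x f + (U * X) * f) + (X * ∂x g + (U * X) * g)
      ≈⟨ solve 6 (λ x f′ w f g g′ → (x :* f′ :+ w :* f) :+ (x :* g′ :+ w :* g) := x :* (f′ :+ g′) :+ w :* (f :+ g)) refl X (∂x f) (U * X) f g (∂x g) ⟩
    X * (∂x f + ∂x g) + (U * X) * (f + g)                       ≈⟨ +-congʳ (*-congˡ (Dx.D-+ f g)) ⟨
    X * ∂x (f + g) + (U * X) * (f + g)                          ∎

  module Exponentials
    (∂x-X : ∂x X ≈ 1#) (∂x-Y : ∂x Y ≈ 0#) (∂x-U : ∂x U ≈ 0#)
    (∂y-X : ∂y X ≈ 0#) (∂y-Y : ∂y Y ≈ 1#) (∂y-U : ∂y U ≈ 0#) where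

    ∂x-UX : ∂x (U * X) ≈ U
    ∂x-UX = trans (∂x-constant-* U X ∂x-U) (trans (*-congˡ ∂x-X) (*-identityʳ U))

    ∂y-UX : ∂y (U * X) ≈ 0#
    ∂y-UX = trans (∂y-constant-* U X ∂y-U) (trans (*-congˡ ∂y-X) (zeroʳ U))

    ∂x-UXf : ∀ f → ∂x f ≈ 0# → ∂x (U * X * f) ≈ U * f
    ∂x-UXf f ∂xf≈0 = begin
      ∂x (U * X * f)                     ≈⟨ Dx.D-* (U * X) f ⟩
      ∂x (U * X) * f + U * X * ∂x f      ≈⟨ +-cong (*-congʳ ∂x-UX) (trans (*-congˡ ∂xf≈0) (zeroʳ _)) ⟩
      U * f + 0#                         ≈⟨ +-identityʳ _ ⟩
      U * f                              ∎

    ∂y-UXf : ∀ f → ∂y f ≈ 1# → ∂y (U * X * f) ≈ U * X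
    ∂y-UXf f ∂yf≈1 = trans (∂y-constant-* (U * X) f ∂y-UX) (trans (*-congˡ ∂yf≈1) (*-identityʳ _))

    ∂x-1+Y : ∂x (1# + Y) ≈ 0#
    ∂x-1+Y = trans (Dx.D-+ 1# Y) (trans (+-cong Dx.D-1 ∂x-Y) (+-identityʳ 0#))

    ∂y-1+Y : ∂y (1# + Y) ≈ 1#
    ∂y-1+Y = trans (Dy.D-+ 1# Y) (trans (+-cong Dy.D-1 ∂y-Y) (+-identityˡ 1#))

    -- Only the logarithmic derivatives of `e` enter, so this is a property of the exponent h =
    -- ux(1+y): both (1+y) ∂h/∂y and x ∂h/∂x equal h.
    exp-invariant : ∀ e → ∂x e ≈ e * ∂x (U * X * (1# + Y)) → ∂y e ≈ e * ∂y (U * X * (1# + Y)) → Invariant e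
    exp-invariant e ∂xe ∂ye = begin
      (1# + Y) * ∂y e                ≈⟨ *-congˡ (trans ∂ye (*-congˡ (∂y-UXf (1# + Y) ∂y-1+Y))) ⟩
      (1# + Y) * (e * (U * X))       ≈⟨ solve 4 (λ y e u x → y :* (e :* (u :* x)) := x :* (e :* (u :* y))) refl (1# + Y) e U X ⟩
      X * (e * (U * (1# + Y)))       ≈⟨ *-congˡ (trans ∂xe (*-congˡ (∂x-UXf (1# + Y) ∂x-1+Y))) ⟨
      X * ∂x e                       ∎

    -- For the exponent uxy, the left side (1+y) · ux exceeds x · uy by ux, which is the
    -- zeroth-order coefficient of the equation.
    exp-transported : ∀ e → ∂x e ≈ e * ∂x (U * X * Y) → ∂y e ≈ e * ∂y (U * X * Y) → Transported e
    exp-transported e ∂xe ∂ye = begin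
      (1# + Y) * ∂y e                  ≈⟨ *-congˡ (trans ∂ye (*-congˡ (∂y-UXf Y ∂y-Y))) ⟩
      (1# + Y) * (e * (U * X))         ≈⟨ solve 4 (λ y e u x → (con 1 :+ y) :* (e :* (u :* x)) := x :* (e :* (u :* y)) :+ (u :* x) :* e) refl Y e U X ⟩
      X * (e * (U * Y)) + (U * X) * e  ≈⟨ +-congʳ (*-congˡ (trans ∂xe (*-congˡ (∂x-UXf Y ∂x-Y)))) ⟨
      X * ∂x e + (U * X) * e           ∎

-- Power series in two variables

module SeriesRing {c ℓ : Level} (R : CommutativeRing c ℓ) where

  open CommutativeRing R
  open SemiringSum semiring using (sum)
  open SemiringMult semiring renaming (_×_ to _·_)
  open FiniteSum R
  open SetoidReasoning setoid
  private
    module 1D = Convolution R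
    module 2D = Convolution 1D.seqRing
    module 1D-sum = SemiringSum (CommutativeRing.semiring 1D.seqRing)
    module 1D-mult = SemiringMult (CommutativeRing.semiring 1D.seqRing)
  open PowerSeries (Ring.rawRing ring) using
    (Series; _≈ˢ_; _+ˢ_; _*ˢ_; -ˢ_; _-ˢ_; _^ˢ_; 1ˢ; const; X; Y; compose; series-rawRing)

  private
    sum-at : ∀ m (h : Fin m → 1D.Seq) j → 1D-sum.sum h j ≈ sum λ a → h a j
    sum-at zero    h j = refl
    sum-at (suc m) h j = +-congˡ (sum-at m (h ∘ suc) j)

    ·-at : ∀ n (f : 1D.Seq) j → (n 1D-mult.× f) j ≈ n · f j
    ·-at zero    f j = refl
    ·-at (suc n) f j = +-congˡ (·-at n f j)

    *ˢ≈⊛ : ∀ f g → f *ˢ g ≈ˢ f 2D.⊛ g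
    *ˢ≈⊛ f g n j = sym (sum-at (suc n) (λ a → f (toℕ a) 1D.⊛ g (n ∸ toℕ a)) j)

  const≈constant : ∀ a → const a ≈ˢ 2D.constant (1D.constant a)
  const≈constant a zero    zero    = refl
  const≈constant a zero    (suc j) = refl
  const≈constant a (suc n) j       = refl

  const-zero : const 0# ≈ˢ λ _ _ → 0#
  const-zero zero    zero    = refl
  const-zero zero    (suc j) = refl
  const-zero (suc n) j       = refl

  abstract
    -- The two-variable operations differ from those of the iterated ring only in presentation: the
    -- product is a double sum, and constants are defined by matching on both indices. The identity
    -- map is therefore a monomorphism along which the axioms are pulled back.
    series-isCommutativeRing :
      IsCommutativeRing _≈ˢ_ _+ˢ_ _*ˢ_ -ˢ_ (const 0#) 1ˢ
    series-isCommutativeRing = RingMonomorphism.isCommutativeRing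
      {R₁ = series-rawRing} {R₂ = 2D.seq-rawRing} {⟦_⟧ = λ f → f} (record
        { isRingHomomorphism = record
          { isSemiringHomomorphism = record
            { isNearSemiringHomomorphism = record
              { +-isMonoidHomomorphism = record
                { isMagmaHomomorphism = record
                  { isRelHomomorphism = record { cong = λ f≈g → f≈g }
                  ; homo = λ f g n j → refl
                  }
                ; ε-homo = const-zero
                }
              ; *-homo = *ˢ≈⊛
              }
            ; 1#-homo = const≈constant 1#
            }
          ; -‿homo = λ f n j → refl
          }
        ; injective = λ f≈g → f≈g
        })
      (CommutativeRing.isCommutativeRing 2D.seqRing)

  seriesRing : CommutativeRing c ℓ
  seriesRing = record { isCommutativeRing = series-isCommutativeRing }

  private
    module S = CommutativeRing seriesRing
    module S-sum = SemiringSum S.semiring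
    module S-mult = SemiringMult S.semiring

  sumˢ-at : ∀ m (h : Fin m → Series) n j → S-sum.sum h n j ≈ sum λ a → h a n j
  sumˢ-at zero    h n j = const-zero n j
  sumˢ-at (suc m) h n j = +-congˡ (sumˢ-at m (h ∘ suc) n j)

  ·ˢ-at : ∀ m f n j → (m S-mult.× f) n j ≈ m · f n j
  ·ˢ-at zero    f n j = const-zero n j
  ·ˢ-at (suc m) f n j = +-congˡ (·ˢ-at m f n j)

  const-* : ∀ a f n j → (const a *ˢ f) n j ≈ a * f n j
  const-* a f n j = begin
    (const a *ˢ f) n j                          ≈⟨ S.*-cong {const a} {2D.constant (1D.constant a)} {f} {f} (const≈constant a) (S.refl {f}) n j ⟩
    (2D.constant (1D.constant a) *ˢ f) n j      ≈⟨ *ˢ≈⊛ (2D.constant (1D.constant a)) f n j ⟩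
    (2D.constant (1D.constant a) 2D.⊛ f) n j    ≈⟨ 2D.constant-⊛ (1D.constant a) f n j ⟩
    (1D.constant a 1D.⊛ f n) j                  ≈⟨ 1D.constant-⊛ a (f n) j ⟩
    a * f n j                                   ∎

  private
    X≈var : X ≈ˢ 2D.var
    X≈var 0             j       = refl
    X≈var 1             zero    = refl
    X≈var 1             (suc j) = refl
    X≈var (suc (suc n)) j       = refl

    Y≈var : Y ≈ˢ 2D.constant 1D.var
    Y≈var zero    0             = refl
    Y≈var zero    1             = refl
    Y≈var zero    (suc (suc j)) = refl
    Y≈var (suc n) j             = refl

    X-*-⊛ : ∀ f n j → (X *ˢ f) n j ≈ (2D.var 2D.⊛ f) n j
    X-*-⊛ f n j = trans (S.*-cong {X} {2D.var} {f} {f} X≈var (S.refl {f}) n j) (*ˢ≈⊛ 2D.var f n j)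

    Y-*-⊛ : ∀ f n j → (Y *ˢ f) n j ≈ (1D.var 1D.⊛ f n) j
    Y-*-⊛ f n j = begin
      (Y *ˢ f) n j                         ≈⟨ S.*-cong {Y} {2D.constant 1D.var} {f} {f} Y≈var (S.refl {f}) n j ⟩
      (2D.constant 1D.var *ˢ f) n j        ≈⟨ *ˢ≈⊛ (2D.constant 1D.var) f n j ⟩
      (2D.constant 1D.var 2D.⊛ f) n j      ≈⟨ 2D.constant-⊛ 1D.var f n j ⟩
      (1D.var 1D.⊛ f n) j                  ∎

  X-*-zero : ∀ f j → (X *ˢ f) 0 j ≈ 0#
  X-*-zero f j = trans (X-*-⊛ f 0 j) (2D.var-⊛-zero f j)

  X-*-suc : ∀ f n j → (X *ˢ f) (suc n) j ≈ f n j
  X-*-suc f n j = trans (X-*-⊛ f (suc n) j) (2D.var-⊛-suc f n j)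

  Y-*-zero : ∀ f n → (Y *ˢ f) n 0 ≈ 0#
  Y-*-zero f n = trans (Y-*-⊛ f n 0) (1D.var-⊛-zero (f n))

  Y-*-suc : ∀ f n j → (Y *ˢ f) n (suc j) ≈ f n j
  Y-*-suc f n j = trans (Y-*-⊛ f n (suc j)) (1D.var-⊛-suc (f n) j)

  -- Setting y = 0 is multiplicative, because at j = 0 the inner sum has a single term.
  *ˢ-at-y⁰ : ∀ f g n → (f *ˢ g) n 0 ≈ ((λ m → f m 0) 1D.⊛ (λ m → g m 0)) n
  *ˢ-at-y⁰ f g n = sum-cong (suc n) _ _ λ a → +-identityʳ (f (toℕ a) 0 * g (n ∸ toℕ a) 0)

  ∂x ∂y : Series → Series
  ∂x f n j = suc n · f (suc n) j
  ∂y f n j = suc j · f n (suc j)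

  ∂x-* : ∀ f g → ∂x (f *ˢ g) ≈ˢ ∂x f *ˢ g +ˢ f *ˢ ∂x g
  ∂x-* f g n j = begin
    suc n · (f *ˢ g) (suc n) j                ≈⟨ ×-congʳ (suc n) (*ˢ≈⊛ f g (suc n) j) ⟩
    suc n · (f 2D.⊛ g) (suc n) j              ≈⟨ ·-at (suc n) ((f 2D.⊛ g) (suc n)) j ⟨
    2D.∂ (f 2D.⊛ g) n j                       ≈⟨ 2D.∂-⊛ f g n j ⟩
    (2D.∂ f 2D.⊛ g) n j + (f 2D.⊛ 2D.∂ g) n j ≈⟨ +-cong (*ˢ≈⊛ (2D.∂ f) g n j) (*ˢ≈⊛ f (2D.∂ g) n j) ⟨
    (2D.∂ f *ˢ g) n j + (f *ˢ 2D.∂ g) n j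
      ≈⟨ +-cong (S.*-cong {2D.∂ f} {∂x f} {g} {g} (∂≈∂x f) (S.refl {g}) n j)
                (S.*-cong {f} {f} {2D.∂ g} {∂x g} (S.refl {f}) (∂≈∂x g) n j) ⟩
    (∂x f *ˢ g) n j + (f *ˢ ∂x g) n j         ∎
    where
    ∂≈∂x : ∀ f → 2D.∂ f ≈ˢ ∂x f
    ∂≈∂x f n j = ·-at (suc n) (f (suc n)) j

  -- Here the derivation acts on the coefficients of the series in x: the one-variable rule in y is
  -- applied to each summand of the convolution in x.
  ∂y-* : ∀ f g → ∂y (f *ˢ g) ≈ˢ ∂y f *ˢ g +ˢ f *ˢ ∂y g
  ∂y-* f g n j = begin
    suc j · sum {suc n} (λ a → (f (toℕ a) 1D.⊛ g (n ∸ toℕ a)) (suc j))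
      ≈⟨ sum-· (suc n) (suc j) (λ a → (f (toℕ a) 1D.⊛ g (n ∸ toℕ a)) (suc j)) ⟨
    sum {suc n} (λ a → 1D.∂ (f (toℕ a) 1D.⊛ g (n ∸ toℕ a)) j)
      ≈⟨ sum-cong (suc n) _ _ (λ a → 1D.∂-⊛ (f (toℕ a)) (g (n ∸ toℕ a)) j) ⟩
    sum {suc n} (λ a → (1D.∂ (f (toℕ a)) 1D.⊛ g (n ∸ toℕ a)) j + (f (toℕ a) 1D.⊛ 1D.∂ (g (n ∸ toℕ a))) j)
      ≈⟨ sum-+ (suc n) (λ a → (1D.∂ (f (toℕ a)) 1D.⊛ g (n ∸ toℕ a)) j) (λ a → (f (toℕ a) 1D.⊛ 1D.∂ (g (n ∸ toℕ a))) j) ⟩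
    (∂y f *ˢ g) n j + (f *ˢ ∂y g) n j
      ∎

  sum-truncate : ∀ {m n} → m ℕ.≤ n → (f : ℕ → Carrier) → (∀ k → m ℕ.≤ k → f k ≈ 0#) →
    sum {n} (f ∘ toℕ) ≈ sum {m} (f ∘ toℕ)
  sum-truncate {n = n} z≤n       f f≈0 = sum-zero n _ λ i → f≈0 (toℕ i) z≤n
  sum-truncate         (s≤s m≤n) f f≈0 =
    +-congˡ (sum-truncate m≤n (f ∘ suc) λ k m≤k → f≈0 (suc k) (s≤s m≤k))

  ∸-+-∸ : ∀ {n j a b} → a ℕ.≤ n → b ℕ.≤ j → (a ℕ.+ b) ℕ.+ ((n ∸ a) ℕ.+ (j ∸ b)) ≡ n ℕ.+ j
  ∸-+-∸ {n} {j} {a} {b} a≤n b≤j =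
    ≡.trans (interchange a b (n ∸ a) (j ∸ b)) (≡.cong₂ ℕ._+_ (ℕ.m+[n∸m]≡n a≤n) (ℕ.m+[n∸m]≡n b≤j))
    where open CommutativeSemigroupProperties ℕ.+-commutativeSemigroup using (interchange)

  -- For replacing a composite by a partial sum inside a product: a term of the product never uses f
  -- above its own total degree.
  *ˢ-local : ∀ f f′ g N → (∀ a b → a ℕ.+ b ℕ.≤ N → f a b ≈ f′ a b) →
    ∀ n j → n ℕ.+ j ℕ.≤ N → (f *ˢ g) n j ≈ (f′ *ˢ g) n j
  *ˢ-local f f′ g N f≈f′ n j n+j≤N =
    sum-cong (suc n) (λ a → sum {suc j} λ b → f (toℕ a) (toℕ b) * g (n ∸ toℕ a) (j ∸ toℕ b)) _ λ a →
    sum-cong (suc j) (λ b → f (toℕ a) (toℕ b) * g (n ∸ toℕ a) (j ∸ toℕ b)) _ λ b →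
    *-congʳ {g (n ∸ toℕ a) (j ∸ toℕ b)} (f≈f′ (toℕ a) (toℕ b)
      (ℕ.≤-trans (ℕ.+-mono-≤ (Fin.toℕ≤pred[n] a) (Fin.toℕ≤pred[n] b)) n+j≤N))

  -- The term a = b = 0 vanishes because h has no constant term; in every other term f is evaluated
  -- in a total degree lower by at least one.
  *ˢ-order : ∀ h f k → h 0 0 ≈ 0# → (∀ n j → n ℕ.+ j ℕ.< k → f n j ≈ 0#) →
    ∀ n j → n ℕ.+ j ℕ.< suc k → (h *ˢ f) n j ≈ 0#
  *ˢ-order h f k h₀≈0 f≈0 n j (s≤s n+j≤k) =
    sum-zero (suc n) _ λ a → sum-zero (suc j) _ λ b →
    term (toℕ a) (toℕ b) (Fin.toℕ≤pred[n] a) (Fin.toℕ≤pred[n] b)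
    where
    lower : ∀ a b → a ℕ.≤ n → b ℕ.≤ j → 0 ℕ.< a ℕ.+ b → (n ∸ a) ℕ.+ (j ∸ b) ℕ.< k
    lower a b a≤n b≤j 0<a+b = ℕ.<-≤-trans
      (≡.subst ((n ∸ a) ℕ.+ (j ∸ b) ℕ.<_) (∸-+-∸ a≤n b≤j) (ℕ.+-monoˡ-≤ ((n ∸ a) ℕ.+ (j ∸ b)) 0<a+b))
      n+j≤k
    term : ∀ a b → a ℕ.≤ n → b ℕ.≤ j → h a b * f (n ∸ a) (j ∸ b) ≈ 0#
    term zero    zero    _   _   = trans (*-congʳ h₀≈0) (zeroˡ _)
    term zero    (suc b) a≤n b≤j = trans (*-congˡ (f≈0 _ _ (lower 0 (suc b) a≤n b≤j (s≤s z≤n)))) (zeroʳ _)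
    term (suc a) b       a≤n b≤j = trans (*-congˡ (f≈0 _ _ (lower (suc a) b a≤n b≤j (s≤s z≤n)))) (zeroʳ _)

  geometric : Series → Series
  geometric h = compose (λ _ → 1#) h

  module _ (h : Series) (h₀≈0 : h 0 0 ≈ 0#) where

    ^ˢ-order : ∀ k n j → n ℕ.+ j ℕ.< k → (h ^ˢ k) n j ≈ 0#
    ^ˢ-order (suc k) = *ˢ-order h (h ^ˢ k) k h₀≈0 (^ˢ-order k)

    truncation : (ℕ → Carrier) → ℕ → Series
    truncation c N = S-sum.sum {N} λ k → const (c (toℕ k)) *ˢ h ^ˢ toℕ k

    -- Makes ring laws available for `compose`: powers beyond n + j do not reach this coefficient,
    -- so the number of terms may be fixed in advance at any N > n + j.
    compose≈truncation : ∀ c N n j → n ℕ.+ j ℕ.< N → compose c h n j ≈ truncation c N n j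
    compose≈truncation c N n j n+j<N = begin
      sum {suc (n ℕ.+ j)} (λ k → c (toℕ k) * (h ^ˢ toℕ k) n j)
        ≈⟨ sum-truncate n+j<N (λ k → c k * (h ^ˢ k) n j) (λ k n+j<k → trans (*-congˡ (^ˢ-order k n j n+j<k)) (zeroʳ _)) ⟨
      sum {N} (λ k → c (toℕ k) * (h ^ˢ toℕ k) n j)
        ≈⟨ sum-cong N _ _ (λ k → const-* (c (toℕ k)) (h ^ˢ toℕ k) n j) ⟨
      sum {N} (λ k → (const (c (toℕ k)) *ˢ h ^ˢ toℕ k) n j)
        ≈⟨ sumˢ-at N (λ k → const (c (toℕ k)) *ˢ h ^ˢ toℕ k) n j ⟨
      truncation c N n j
        ∎

    private
      truncation-≤ : ∀ c N n j → n ℕ.+ j ℕ.≤ N → compose c h n j ≈ truncation c (suc N) n j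
      truncation-≤ c N n j n+j≤N = compose≈truncation c (suc N) n j (s≤s n+j≤N)

    compose-* : ∀ c g n j → (truncation c (suc (n ℕ.+ j)) *ˢ g) n j ≈ (compose c h *ˢ g) n j
    compose-* c g n j = *ˢ-local (truncation c (suc (n ℕ.+ j))) (compose c h) g (n ℕ.+ j)
      (λ a b a+b≤N → sym (truncation-≤ c (n ℕ.+ j) a b a+b≤N)) n j ℕ.≤-refl

    geometric-fixpoint : geometric h ≈ˢ 1ˢ +ˢ geometric h *ˢ h
    geometric-fixpoint n j = begin
      geometric h n j
        -- One term more than the coefficient requires: the first is split off as 1, and the n + j +
        -- 1 terms that remain are what `compose-*` expects.
        ≈⟨ compose≈truncation (λ _ → 1#) (2 ℕ.+ (n ℕ.+ j)) n j (ℕ.m≤n⇒m≤1+n ℕ.≤-refl) ⟩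
      truncation (λ _ → 1#) (2 ℕ.+ (n ℕ.+ j)) n j
        ≈⟨ S.+-cong {1ˢ *ˢ 1ˢ} {1ˢ} (S.*-identityˡ 1ˢ) tail n j ⟩
      1ˢ n j + (truncation (λ _ → 1#) (suc (n ℕ.+ j)) *ˢ h) n j
        ≈⟨ +-congˡ (compose-* (λ _ → 1#) h n j) ⟩
      1ˢ n j + (geometric h *ˢ h) n j
        ∎
      where
      open FiniteSum seriesRing renaming (sum-cong to sumˢ-cong; sum-*ʳ to sumˢ-*ʳ) using ()
      tail : S-sum.sum {suc (n ℕ.+ j)} (λ k → 1ˢ *ˢ h ^ˢ suc (toℕ k)) ≈ˢ truncation (λ _ → 1#) (suc (n ℕ.+ j)) *ˢ h
      tail = S.trans {S-sum.sum {suc (n ℕ.+ j)} (λ k → 1ˢ *ˢ h ^ˢ suc (toℕ k))}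
                     {S-sum.sum {suc (n ℕ.+ j)} (λ k → (1ˢ *ˢ h ^ˢ toℕ k) *ˢ h)}
                     {truncation (λ _ → 1#) (suc (n ℕ.+ j)) *ˢ h}
        (sumˢ-cong (suc (n ℕ.+ j)) (λ k → 1ˢ *ˢ h ^ˢ suc (toℕ k)) (λ k → (1ˢ *ˢ h ^ˢ toℕ k) *ˢ h) λ k →
          S.trans {1ˢ *ˢ (h *ˢ h ^ˢ toℕ k)} {1ˢ *ˢ (h ^ˢ toℕ k *ˢ h)} {(1ˢ *ˢ h ^ˢ toℕ k) *ˢ h}
            (S.*-cong {1ˢ} {1ˢ} {h *ˢ h ^ˢ toℕ k} {h ^ˢ toℕ k *ˢ h} (S.refl {1ˢ}) (S.*-comm h (h ^ˢ toℕ k)))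
            (S.sym {(1ˢ *ˢ h ^ˢ toℕ k) *ˢ h} {1ˢ *ˢ (h ^ˢ toℕ k *ˢ h)} (S.*-assoc 1ˢ (h ^ˢ toℕ k) h)))
        (sumˢ-*ʳ (suc (n ℕ.+ j)) h (λ k → 1ˢ *ˢ h ^ˢ toℕ k))

-- Permutations by first letter and descents

-- Booleans extracted from the decision procedures behind `isCounted?`, so that `distinct (a ∷ w)`
-- reduces to `avoids a w ∧ distinct w`.
distinct : ∀ {n m} → Vec (Fin n) m → Bool
distinct w = does (AllPairs.allPairs? (λ a b → ¬? (a Fin.≟ b)) w)

avoids : ∀ {n m} → Fin n → Vec (Fin n) m → Bool
avoids a w = does (All.all? (λ b → ¬? (a Fin.≟ b)) w)

-- `punchIn j` is the increasing injection that omits j, so it undoes the standardisation that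
-- follows the deletion of the letter j.
≟-punchIn : ∀ {n} j (a b : Fin n) → does (punchIn j a Fin.≟ punchIn j b) ≡ does (a Fin.≟ b)
≟-punchIn zero    a       b       = ≡.refl
≟-punchIn (suc j) zero    zero    = ≡.refl
≟-punchIn (suc j) zero    (suc b) = ≡.refl
≟-punchIn (suc j) (suc a) zero    = ≡.refl
≟-punchIn (suc j) (suc a) (suc b) = ≟-punchIn j a b

<?-punchIn : ∀ {n} j (a b : Fin n) → does (punchIn j a Fin.<? punchIn j b) ≡ does (a Fin.<? b)
<?-punchIn zero    a       b       = ≡.refl
<?-punchIn (suc j) zero    zero    = ≡.refl
<?-punchIn (suc j) zero    (suc b) = ≡.refl
<?-punchIn (suc j) (suc a) zero    = ≡.refl
<?-punchIn (suc j) (suc a) (suc b) = <?-punchIn j a b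

-- Letters below j stay and the others move above j; this decides whether a deleted first letter j
-- had made a descent.
punchIn-<? : ∀ {n} j (a : Fin n) → does (punchIn j a Fin.<? j) ≡ (toℕ a <ᵇ toℕ j)
punchIn-<? zero    a       = ≡.refl
punchIn-<? (suc j) zero    = ≡.refl
punchIn-<? (suc j) (suc a) = punchIn-<? j a

avoids-punchIn : ∀ {n m} j a (w : Vec (Fin n) m) →
  avoids (punchIn j a) (Vec.map (punchIn j) w) ≡ avoids a w
avoids-punchIn j a []      = ≡.refl
avoids-punchIn j a (b ∷ w) =
  ≡.cong₂ (λ x y → not x ∧ y) (≟-punchIn j a b) (avoids-punchIn j a w)

distinct-punchIn : ∀ {n m} j (w : Vec (Fin n) m) → distinct (Vec.map (punchIn j) w) ≡ distinct w
distinct-punchIn j []      = ≡.refl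
distinct-punchIn j (a ∷ w) = ≡.cong₂ _∧_ (avoids-punchIn j a w) (distinct-punchIn j w)

des-punchIn : ∀ {n m} j (w : Vec (Fin n) m) → des (Vec.map (punchIn j) w) ≡ des w
des-punchIn j []          = ≡.refl
des-punchIn j (a ∷ [])    = ≡.refl
des-punchIn j (a ∷ b ∷ w) =
  ≡.cong₂ (λ x y → (if x then 1 else 0) ℕ.+ y) (<?-punchIn j b a) (des-punchIn j (b ∷ w))

des-∷-punchIn : ∀ {n m} j a (w : Vec (Fin n) m) →
  des (j ∷ Vec.map (punchIn j) (a ∷ w)) ≡ (if toℕ a <ᵇ toℕ j then 1 else 0) ℕ.+ des (a ∷ w)
des-∷-punchIn j a w =
  ≡.cong₂ (λ x y → (if x then 1 else 0) ℕ.+ y) (punchIn-<? j a) (des-punchIn j (a ∷ w))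

-- Ensures that a sum over d below the length of the word meets its number of descents.
des<length : ∀ {n m} (w : Vec (Fin n) (suc m)) → des w ℕ.< suc m
des<length (a ∷ [])    = s≤s z≤n
des<length (a ∷ b ∷ w) = ℕ.+-mono-≤-< (bit≤1 (does (b Fin.<? a))) (des<length (b ∷ w))
  where
  bit≤1 : ∀ x → (if x then 1 else 0) ℕ.≤ 1
  bit≤1 true  = s≤s z≤n
  bit≤1 false = z≤n

toℕ-<ᵇ : ∀ {n} (i : Fin n) → (toℕ i <ᵇ n) ≡ true
toℕ-<ᵇ zero    = ≡.refl
toℕ-<ᵇ (suc i) = toℕ-<ᵇ i

-- Descent polynomials and their recurrences

module DescentPolynomials {c ℓ : Level} (R : CommutativeRing c ℓ) (t : CommutativeRing.Carrier R) where

  open CommutativeRing R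
  open SemiringSum semiring using (sum)
  open SemiringMult semiring renaming (_×_ to _·_)
  open RawSemiringDefs (Semiring.rawSemiring semiring) using (_^_)
  open FiniteSum R
  open RingSolver commutativeSemiring using (solve; _:=_; _:+_; _:*_; con)
  open SetoidReasoning setoid

  infix 0 _when_
  _when_ : Carrier → Bool → Carrier
  x when b = if b then x else 0#

  when-cong : ∀ b {x y} → x ≈ y → (x when b) ≈ (y when b)
  when-cong true  x≈y = x≈y
  when-cong false x≈y = refl

  ∑list : ∀ {a} {A : Set a} → List A → (A → Carrier) → Carrier
  ∑list xs g = List.foldr (λ x s → g x + s) 0# xs

  ∑list-cong : ∀ {a} {A : Set a} (xs : List A) {g h : A → Carrier} →
    (∀ x → g x ≈ h x) → ∑list xs g ≈ ∑list xs h
  ∑list-cong []       g≈h = refl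
  ∑list-cong (x ∷ xs) g≈h = +-cong (g≈h x) (∑list-cong xs g≈h)

  ∑list-++ : ∀ {a} {A : Set a} (xs ys : List A) (g : A → Carrier) →
    ∑list (xs ++ ys) g ≈ ∑list xs g + ∑list ys g
  ∑list-++ []       ys g = sym (+-identityˡ _)
  ∑list-++ (x ∷ xs) ys g = trans (+-congˡ (∑list-++ xs ys g)) (sym (+-assoc _ _ _))

  ∑list-map : ∀ {a b} {A : Set a} {B : Set b} (f : A → B) xs (g : B → Carrier) →
    ∑list (List.map f xs) g ≈ ∑list xs (g ∘ f)
  ∑list-map f []       g = refl
  ∑list-map f (x ∷ xs) g = +-congˡ (∑list-map f xs g)

  ∑list-cartesianProductWith : ∀ {a} {A B C : Set a} (f : A → B → C) xs ys (g : C → Carrier) →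
    ∑list (List.cartesianProductWith f xs ys) g ≈ ∑list xs λ x → ∑list ys λ y → g (f x y)
  ∑list-cartesianProductWith f []       ys g = refl
  ∑list-cartesianProductWith f (x ∷ xs) ys g =
    trans (∑list-++ (List.map (f x) ys) _ g)
          (+-cong (∑list-map (f x) ys g) (∑list-cartesianProductWith f xs ys g))

  ∑list-tabulate : ∀ {a} {A : Set a} {n} (f : Fin n → A) (g : A → Carrier) →
    ∑list (List.tabulate f) g ≈ sum (g ∘ f)
  ∑list-tabulate {n = zero}  f g = refl
  ∑list-tabulate {n = suc n} f g = +-congˡ (∑list-tabulate (f ∘ suc) g)

  sum-∑list : ∀ {a} {A : Set a} n (xs : List A) (g : Fin n → A → Carrier) →
    sum (λ d → ∑list xs (g d)) ≈ ∑list xs λ x → sum λ d → g d x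
  sum-∑list n []       g = sum-zero n _ λ _ → refl
  sum-∑list n (x ∷ xs) g =
    trans (sum-+ n (λ d → g d x) (λ d → ∑list xs (g d))) (+-congˡ (sum-∑list n xs g))

  -- Turns a count into a sum of weights, so that the sums over d and over words can be exchanged.
  length-filter : ∀ {a p} {A : Set a} {P : Pred A p} (P? : Decidable P) xs x →
    List.length (List.filter P? xs) · x ≈ ∑list xs λ a → x when does (P? a)
  length-filter P? []       x = refl
  length-filter P? (a ∷ xs) x with does (P? a)
  ... | true  = +-congˡ (length-filter P? xs x)
  ... | false = trans (length-filter P? xs x) (sym (+-identityˡ _))

  sum-when-≡ : ∀ {n e} → e ℕ.< n → (f : ℕ → Carrier) →
    sum {n} (λ d → f (toℕ d) when (e ≡ᵇ toℕ d)) ≈ f e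
  sum-when-≡ {suc n} {zero}  (s≤s e<n) f = trans (+-congˡ (sum-zero n _ λ _ → refl)) (+-identityʳ _)
  sum-when-≡ {suc n} {suc e} (s≤s e<n) f = trans (+-identityˡ _) (sum-when-≡ e<n (f ∘ suc))

  sum-when-≡ʳ : ∀ {n e} → e ℕ.< n → (f : ℕ → Carrier) →
    sum {n} (λ d → f (toℕ d) when (toℕ d ≡ᵇ e)) ≈ f e
  sum-when-≡ʳ {suc n} {zero}  (s≤s e<n) f = trans (+-congˡ (sum-zero n _ λ _ → refl)) (+-identityʳ _)
  sum-when-≡ʳ {suc n} {suc e} (s≤s e<n) f = trans (+-identityˡ _) (sum-when-≡ʳ e<n (f ∘ suc))

  ∑words : ∀ n m → (Vec (Fin n) m → Carrier) → Carrier
  ∑words n zero    g = g []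
  ∑words n (suc m) g = sum λ a → ∑words n m λ w → g (a ∷ w)

  ∑words-cong : ∀ n m {g h : Vec (Fin n) m → Carrier} → (∀ w → g w ≈ h w) → ∑words n m g ≈ ∑words n m h
  ∑words-cong n zero    g≈h = g≈h []
  ∑words-cong n (suc m) g≈h = sum-cong n _ _ λ a → ∑words-cong n m λ w → g≈h (a ∷ w)

  ∑words-zero : ∀ n m → ∑words n m (λ _ → 0#) ≈ 0#
  ∑words-zero n zero    = refl
  ∑words-zero n (suc m) = sum-zero n _ λ _ → ∑words-zero n m

  ∑words-*ˡ : ∀ n m x (g : Vec (Fin n) m → Carrier) → ∑words n m (λ w → x * g w) ≈ x * ∑words n m g
  ∑words-*ˡ n zero    x g = refl
  ∑words-*ˡ n (suc m) x g =
    trans (sum-cong n _ _ λ a → ∑words-*ˡ n m x (g ∘ (a ∷_))) (sum-*ˡ n x λ a → ∑words n m (g ∘ (a ∷_)))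

  ∑words-when : ∀ n m b (g : Vec (Fin n) m → Carrier) →
    ∑words n m (λ w → g w when b) ≈ (∑words n m g when b)
  ∑words-when n m true  g = refl
  ∑words-when n m false g = ∑words-zero n m

  ∑list-words : ∀ n m (g : Vec (Fin n) m → Carrier) → ∑list (words n m) g ≈ ∑words n m g
  ∑list-words n zero    g = +-identityʳ _
  ∑list-words n (suc m) g = begin
    ∑list (words n (suc m)) g
      ≈⟨ ∑list-cartesianProductWith _∷_ (List.allFin n) (words n m) g ⟩
    ∑list (List.allFin n) (λ a → ∑list (words n m) λ w → g (a ∷ w))
      ≈⟨ ∑list-tabulate id (λ a → ∑list (words n m) λ w → g (a ∷ w)) ⟩
    sum (λ a → ∑list (words n m) λ w → g (a ∷ w))
      ≈⟨ sum-cong n _ _ (λ a → ∑list-words n m (λ w → g (a ∷ w))) ⟩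
    ∑words n (suc m) g
      ∎

  sum-≢ : ∀ {n} (j : Fin (suc n)) (f : Fin (suc n) → Carrier) →
    sum (λ a → f a when not (does (j Fin.≟ a))) ≈ sum (λ i → f (punchIn j i))
  sum-≢         zero    f = +-identityˡ _
  sum-≢ {suc n} (suc j) f = +-congˡ (sum-≢ j (f ∘ suc))

  when-∧ : ∀ x y z → (z when x ∧ y) ≈ ((z when y) when x)
  when-∧ true  y z = refl
  when-∧ false y z = refl

  -- Standardisation, carried out one letter at a time by `sum-≢`.
  ∑words-avoids : ∀ n m j (g : Vec (Fin (suc n)) m → Carrier) →
    ∑words (suc n) m (λ w → g w when avoids j w) ≈ ∑words n m λ w → g (Vec.map (punchIn j) w)
  ∑words-avoids n zero    j g = refl
  ∑words-avoids n (suc m) j g = begin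
    ∑words (suc n) (suc m) (λ w → g w when avoids j w)
      ≈⟨ sum-cong (suc n) (λ a → ∑words (suc n) m λ w → g (a ∷ w) when avoids j (a ∷ w))
           (λ a → ∑words (suc n) m (λ w → g (a ∷ w) when avoids j w) when not (does (j Fin.≟ a)))
           (λ a → trans (∑words-cong (suc n) m λ w → when-∧ (not (does (j Fin.≟ a))) (avoids j w) _)
                        (∑words-when (suc n) m (not (does (j Fin.≟ a))) _)) ⟩
    sum {suc n} (λ a → ∑words (suc n) m (λ w → g (a ∷ w) when avoids j w) when not (does (j Fin.≟ a)))
      ≈⟨ sum-≢ j (λ a → ∑words (suc n) m (λ w → g (a ∷ w) when avoids j w)) ⟩
    sum (λ i → ∑words (suc n) m (λ w → g (punchIn j i ∷ w) when avoids j w))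
      ≈⟨ sum-cong n _ _ (λ i → ∑words-avoids n m j (λ w → g (punchIn j i ∷ w))) ⟩
    ∑words n (suc m) (λ w → g (Vec.map (punchIn j) w))
      ∎

  -- The polynomial Σ_d A(n + 1, d, p + 1) t^d, for p ≤ n.  Deleting the first
  -- letter p + 1 of a permutation and standardising leaves one with some first
  -- letter i + 1; the deleted letter made a descent exactly when i < p.
  B : ℕ → ℕ → Carrier
  B zero    p = 1#
  B (suc n) p = sum {suc n} λ i → (if toℕ i <ᵇ p then t else 1#) * B n (toℕ i)

  weight : ∀ {n m} → Vec (Fin n) m → Carrier
  weight w = t ^ des w when distinct w

  weight-∷-punchIn : ∀ {n m} j a (w : Vec (Fin n) m) →
    (t ^ des (j ∷ Vec.map (punchIn j) (a ∷ w)) when distinct (Vec.map (punchIn j) (a ∷ w)))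
      ≈ (if toℕ a <ᵇ toℕ j then t else 1#) * weight (a ∷ w)
  weight-∷-punchIn j a w
    rewrite des-∷-punchIn j a w | distinct-punchIn j (a ∷ w)
    with distinct (a ∷ w) | toℕ a <ᵇ toℕ j
  ... | true  | true  = refl
  ... | true  | false = sym (*-identityˡ _)
  ... | false | true  = sym (zeroʳ _)
  ... | false | false = sym (zeroʳ _)

  -- Distinctness of `j ∷ w` has two parts. That w avoids j is absorbed by passing to a smaller
  -- alphabet; that w is distinct feeds the induction, with the first letter of w as the summation
  -- index in `B`.
  ∑words-weight : ∀ n (j : Fin (suc n)) → ∑words (suc n) n (λ w → weight (j ∷ w)) ≈ B n (toℕ j)
  ∑words-weight zero    j = refl
  ∑words-weight (suc n) j = begin
    ∑words (2 ℕ.+ n) (suc n) (λ w → weight (j ∷ w))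
      ≈⟨ ∑words-cong (2 ℕ.+ n) (suc n) (λ w → when-∧ (avoids j w) (distinct w) (t ^ des (j ∷ w))) ⟩
    ∑words (2 ℕ.+ n) (suc n) (λ w → (t ^ des (j ∷ w) when distinct w) when avoids j w)
      ≈⟨ ∑words-avoids (suc n) (suc n) j (λ w → t ^ des (j ∷ w) when distinct w) ⟩
    ∑words (suc n) (suc n) (λ w → t ^ des (j ∷ Vec.map (punchIn j) w) when distinct (Vec.map (punchIn j) w))
      ≈⟨ sum-cong (suc n) _ _ (λ a → begin
           ∑words (suc n) n (λ w → t ^ des (j ∷ Vec.map (punchIn j) (a ∷ w)) when distinct (Vec.map (punchIn j) (a ∷ w)))
             ≈⟨ ∑words-cong (suc n) n (weight-∷-punchIn j a) ⟩
           ∑words (suc n) n (λ w → (if toℕ a <ᵇ toℕ j then t else 1#) * weight (a ∷ w))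
             ≈⟨ ∑words-*ˡ (suc n) n _ (λ w → weight (a ∷ w)) ⟩
           (if toℕ a <ᵇ toℕ j then t else 1#) * ∑words (suc n) n (λ w → weight (a ∷ w))
             ≈⟨ *-congˡ (∑words-weight n a) ⟩
           (if toℕ a <ᵇ toℕ j then t else 1#) * B n (toℕ a)
             ∎) ⟩
    B (suc n) (toℕ j)
      ∎

  -- The condition has the form to which `isCounted?` reduces: `x` for distinctness, `e` the number
  -- of descents, `z` the test on the first letter. Only the summand d = e can survive.
  sum-counted : ∀ {m e} x z → e ℕ.< m →
    sum {m} (λ d → t ^ toℕ d when x ∧ ((e ≡ᵇ toℕ d) ∧ z)) ≈ ((t ^ e when x) when z)
  sum-counted {m} true  true  e<m =
    trans (sum-cong m _ _ λ d → when-∧ _ true (t ^ toℕ d)) (sum-when-≡ e<m (t ^_))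
  sum-counted {m} {e} true false e<m = sum-zero m _ λ d → zero-∧ (e ≡ᵇ toℕ d) (t ^ toℕ d)
    where
    zero-∧ : ∀ x y → (y when x ∧ false) ≈ 0#
    zero-∧ true  y = refl
    zero-∧ false y = refl
  sum-counted {m} false true  e<m = sum-zero m _ λ _ → refl
  sum-counted {m} false false e<m = sum-zero m _ λ _ → refl

  sum-A : ∀ n p → p ℕ.≤ n → sum {suc n} (λ d → A (suc n) (toℕ d) (suc p) · t ^ toℕ d) ≈ B n p
  sum-A n p p≤n = begin
    sum {suc n} (λ d → A (suc n) (toℕ d) (suc p) · t ^ toℕ d)
      ≈⟨ sum-cong (suc n) _ _ (λ d → length-filter (isCounted? (toℕ d) (suc p)) (words (suc n) (suc n)) (t ^ toℕ d)) ⟩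
    sum {suc n} (λ d → ∑list (words (suc n) (suc n)) λ w → t ^ toℕ d when does (isCounted? (toℕ d) (suc p) w))
      ≈⟨ sum-∑list (suc n) (words (suc n) (suc n)) (λ d w → t ^ toℕ d when does (isCounted? (toℕ d) (suc p) w)) ⟩
    ∑list (words (suc n) (suc n)) (λ w → sum {suc n} λ d → t ^ toℕ d when does (isCounted? (toℕ d) (suc p) w))
      ≈⟨ ∑list-cong (words (suc n) (suc n)) (λ w → sum-counted (distinct w) (firstLetter w ≡ᵇ suc p) (des<length w)) ⟩
    ∑list (words (suc n) (suc n)) (λ w → weight w when (firstLetter w ≡ᵇ suc p))
      ≈⟨ ∑list-words (suc n) (suc n) _ ⟩
    ∑words (suc n) (suc n) (λ w → weight w when (firstLetter w ≡ᵇ suc p))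
      ≈⟨ sum-cong (suc n) _ _ (λ a → trans (∑words-when (suc n) n (toℕ a ≡ᵇ p) (λ w → weight (a ∷ w)))
                                           (when-cong (toℕ a ≡ᵇ p) (∑words-weight n a))) ⟩
    sum {suc n} (λ a → B n (toℕ a) when (toℕ a ≡ᵇ p))
      ≈⟨ sum-when-≡ʳ (s≤s p≤n) (B n) ⟩
    B n p
      ∎

  -- Raising p by one changes the factor of the single term i = p, from 1 to t = 1 + u; p ≤ n
  -- ensures that this term is present.
  B-suc-suc : ∀ u → t ≈ 1# + u → ∀ n p → p ℕ.≤ n → B (suc n) (suc p) ≈ B (suc n) p + u * B n p
  B-suc-suc u t≈1+u n p p≤n = step (s≤s p≤n) (B n)
    where
    step : ∀ {m p} → p ℕ.< m → (f : ℕ → Carrier) →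
      sum {m} (λ i → (if toℕ i <ᵇ suc p then t else 1#) * f (toℕ i)) ≈
      sum {m} (λ i → (if toℕ i <ᵇ p then t else 1#) * f (toℕ i)) + u * f p
    step {suc m} {zero} (s≤s _) f = begin
      t * f 0 + rest             ≈⟨ +-congʳ (*-congʳ t≈1+u) ⟩
      (1# + u) * f 0 + rest      ≈⟨ solve 3 (λ u x r → (con 1 :+ u) :* x :+ r := con 1 :* x :+ r :+ u :* x) refl u (f 0) rest ⟩
      1# * f 0 + rest + u * f 0  ∎
      where rest = sum {m} (λ i → 1# * f (suc (toℕ i)))
    step {suc m} {suc p} (s≤s p<m) f = trans (+-congˡ (step p<m (f ∘ suc))) (sym (+-assoc _ _ _))

  -- If the first letter is the largest one, it makes a descent whatever follows; if it is the
  -- smallest, it never does.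
  B-last : ∀ n → B (suc n) (suc n) ≈ t * B (suc n) 0
  B-last n = begin
    sum {suc n} (λ i → (if toℕ i <ᵇ suc n then t else 1#) * B n (toℕ i))
      ≈⟨ sum-cong (suc n) _ _ (λ i → *-congʳ {B n (toℕ i)} (reflexive (≡.cong (if_then t else 1#) (toℕ-<ᵇ i)))) ⟩
    sum {suc n} (λ i → t * B n (toℕ i))
      ≈⟨ sum-*ˡ (suc n) t (λ i → B n (toℕ i)) ⟩
    t * sum {suc n} (λ i → B n (toℕ i))
      ≈⟨ *-congˡ (sum-cong (suc n) _ _ λ i → sym (*-identityˡ (B n (toℕ i)))) ⟩
    t * B (suc n) 0
      ∎

-- Reciprocal factorials without division: the two equations force k! · c k = 1, so every positive
-- integer becomes invertible in R.
record IsReciprocalFactorial {r ℓ : Level} (R : CommutativeRing r ℓ)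
  (c : ℕ → CommutativeRing.Carrier R) : Set ℓ where
  open CommutativeRing R hiding (zero)
  open SemiringMult semiring renaming (_×_ to _·_)
  field
    c-zero : c 0 ≈ 1#
    c-suc  : ∀ k → suc k · c (suc k) ≈ c k

<ᵇ-true : ∀ j q → (j <ᵇ suc (j ℕ.+ q)) ≡ true
<ᵇ-true zero    q = ≡.refl
<ᵇ-true (suc j) q = <ᵇ-true j q

<ᵇ-false : ∀ n j → n ℕ.< j → (j <ᵇ suc n) ≡ false
<ᵇ-false zero    (suc j) _         = ≡.refl
<ᵇ-false (suc n) (suc j) (s≤s n<j) = <ᵇ-false n j n<j

-- The identity over a ring with reciprocal factorials

module GeneratingFunction {r ℓ : Level} (R : CommutativeRing r ℓ)
  (t : CommutativeRing.Carrier R)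
  (c : ℕ → CommutativeRing.Carrier R) (isReciprocalFactorial : IsReciprocalFactorial R c) where

  open CommutativeRing R hiding (zero)
  open IsReciprocalFactorial isReciprocalFactorial
  open RingProperties ring using (+-cancelʳ)
  open SemiringMult semiring renaming (_×_ to _·_)
  open FiniteSum R using (·-as-*)
  open RingSolver commutativeSemiring using (solve; _:=_; _:+_; _:*_; con)
  open SetoidReasoning setoid
  open PowerSeries (Ring.rawRing ring) using
    (Series; _≈ˢ_; _+ˢ_; _*ˢ_; _-ˢ_; 1ˢ; const; X; Y; compose)
  open SeriesRing R
  open DescentPolynomials R t
  private
    module S = CommutativeRing seriesRing
    module 1D = Convolution R
    u : Carrier
  u = t + - 1#

  t≈1+u : t ≈ 1# + u
  t≈1+u = begin
    t                    ≈⟨ +-identityʳ t ⟨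
    t + 0#               ≈⟨ +-congˡ (-‿inverseˡ 1#) ⟨
    t + (- 1# + 1#)      ≈⟨ +-assoc t (- 1#) 1# ⟨
    u + 1#               ≈⟨ +-comm u 1# ⟩
    1# + u               ∎

  T U E₁ E₂ : Series
  T  = const t
  U  = T -ˢ 1ˢ
  E₁ = compose c (U *ˢ X *ˢ (1ˢ +ˢ Y))
  E₂ = compose c (U *ˢ X *ˢ Y)

  ·-zeroʳ : ∀ n → n · 0# ≈ 0#
  ·-zeroʳ n = trans (·-as-* n 0#) (zeroʳ _)

  ·-+ : ∀ n x y → n · (x + y) ≈ n · x + n · y
  ·-+ n x y = begin
    n · (x + y)                    ≈⟨ ·-as-* n (x + y) ⟩
    (n · 1#) * (x + y)             ≈⟨ distribˡ _ x y ⟩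
    (n · 1#) * x + (n · 1#) * y    ≈⟨ +-cong (·-as-* n x) (·-as-* n y) ⟨
    n · x + n · y                  ∎

  !·c≈1 : ∀ n → (n !) · c n ≈ 1#
  !·c≈1 zero    = trans (+-identityʳ _) c-zero
  !·c≈1 (suc n) = begin
    (suc n ℕ.* n !) · c (suc n)     ≈⟨ ×-congˡ (ℕ.*-comm (suc n) (n !)) ⟩
    (n ! ℕ.* suc n) · c (suc n)     ≈⟨ ×-assocˡ (c (suc n)) (n !) (suc n) ⟨
    (n !) · (suc n · c (suc n))     ≈⟨ ×-congʳ (n !) (c-suc n) ⟩
    (n !) · c n                     ≈⟨ !·c≈1 n ⟩
    1#                              ∎

  -- The inverse of n + 1 is n! · c (n + 1), since (n + 1)! · c (n + 1) = 1.
  suc-·-cancel : ∀ n x y → suc n · x ≈ suc n · y → x ≈ y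
  suc-·-cancel n x y eq = begin
    x                                         ≈⟨ recover x ⟨
    ((n !) · c (suc n)) * (suc n · x)         ≈⟨ *-congˡ eq ⟩
    ((n !) · c (suc n)) * (suc n · y)         ≈⟨ recover y ⟩
    y                                         ∎
    where
    recover : ∀ z → ((n !) · c (suc n)) * (suc n · z) ≈ z
    recover z = begin
      ((n !) · c (suc n)) * (suc n · z)       ≈⟨ ×-comm-* (suc n) _ z ⟩
      suc n · (((n !) · c (suc n)) * z)       ≈⟨ ×-congʳ (suc n) (×-assoc-* (n !) (c (suc n)) z) ⟩
      suc n · ((n !) · (c (suc n) * z))       ≈⟨ ×-assocˡ _ (suc n) (n !) ⟩
      (suc n !) · (c (suc n) * z)             ≈⟨ ×-assoc-* (suc n !) (c (suc n)) z ⟨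
      ((suc n !) · c (suc n)) * z             ≈⟨ *-congʳ (!·c≈1 (suc n)) ⟩
      1# * z                                  ≈⟨ *-identityˡ z ⟩
      z                                       ∎

  ∂x-const : ∀ a → ∂x (const a) ≈ˢ const 0#
  ∂x-const a n j = trans (·-zeroʳ (suc n)) (sym (const-zero n j))

  ∂y-const : ∀ a → ∂y (const a) ≈ˢ const 0#
  ∂y-const a zero    j = trans (·-zeroʳ (suc j)) (sym (const-zero 0 j))
  ∂y-const a (suc n) j = ·-zeroʳ (suc j)

  ∂x-isDerivation : IsDerivation seriesRing ∂x
  ∂x-isDerivation = record
    { D-cong = λ f g f≈g n j → ×-congʳ (suc n) (f≈g (suc n) j)
    ; D-+    = λ f g n j → ·-+ (suc n) (f (suc n) j) (g (suc n) j)
    ; D-*    = ∂x-*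
    ; D-0    = ∂x-const 0#
    ; D-1    = ∂x-const 1#
    }

  ∂y-isDerivation : IsDerivation seriesRing ∂y
  ∂y-isDerivation = record
    { D-cong = λ f g f≈g n j → ×-congʳ (suc j) (f≈g n (suc j))
    ; D-+    = λ f g n j → ·-+ (suc j) (f n (suc j)) (g n (suc j))
    ; D-*    = ∂y-*
    ; D-0    = ∂y-const 0#
    ; D-1    = ∂y-const 1#
    }

  U≈const : U ≈ˢ const u
  U≈const zero    zero    = refl
  U≈const zero    (suc j) = -‿inverseʳ 0#
  U≈const (suc n) j       = -‿inverseʳ 0#

  ∂x-U : ∂x U ≈ˢ const 0#
  ∂x-U = S.trans {∂x U} {∂x (const u)} {const 0#}
    (IsDerivation.D-cong ∂x-isDerivation U (const u) U≈const) (∂x-const u)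

  ∂y-U : ∂y U ≈ˢ const 0#
  ∂y-U = S.trans {∂y U} {∂y (const u)} {const 0#}
    (IsDerivation.D-cong ∂y-isDerivation U (const u) U≈const) (∂y-const u)

  ∂x-X : ∂x X ≈ˢ 1ˢ
  ∂x-X zero    zero    = +-identityʳ 1#
  ∂x-X zero    (suc j) = ·-zeroʳ 1
  ∂x-X (suc n) j       = ·-zeroʳ (2 ℕ.+ n)

  ∂y-X : ∂y X ≈ˢ const 0#
  ∂y-X 0             j = trans (·-zeroʳ (suc j)) (sym (const-zero 0 j))
  ∂y-X 1             j = ·-zeroʳ (suc j)
  ∂y-X (suc (suc n)) j = ·-zeroʳ (suc j)

  ∂x-Y : ∂x Y ≈ˢ const 0#
  ∂x-Y n j = trans (·-zeroʳ (suc n)) (sym (const-zero n j))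

  ∂y-Y : ∂y Y ≈ˢ 1ˢ
  ∂y-Y zero    zero    = +-identityʳ 1#
  ∂y-Y zero    (suc j) = ·-zeroʳ (2 ℕ.+ j)
  ∂y-Y (suc n) j       = ·-zeroʳ (suc j)

  open Transport seriesRing ∂x ∂y ∂x-isDerivation ∂y-isDerivation X Y U
  open Exponentials ∂x-X ∂x-Y ∂x-U ∂y-X ∂y-Y ∂y-U

  -- D f may involve the coefficients of f one degree higher, hence the suc.
  Local : (Series → Series) → Set (r ⊔ ℓ)
  Local D = ∀ f g N → (∀ a b → a ℕ.+ b ℕ.≤ suc N → f a b ≈ g a b) →
    ∀ n j → n ℕ.+ j ℕ.≤ N → D f n j ≈ D g n j

  ∂x-local : Local ∂x
  ∂x-local f g N f≈g n j n+j≤N = ×-congʳ (suc n) (f≈g (suc n) j (s≤s n+j≤N))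

  ∂y-local : Local ∂y
  ∂y-local f g N f≈g n j n+j≤N =
    ×-congʳ (suc j) (f≈g n (suc j) (ℕ.≤-trans (ℕ.≤-reflexive (ℕ.+-suc n j)) (s≤s n+j≤N)))

  -- The chain rule, for ∂x and ∂y alike. The partial sum has n + j + 2 terms because D may look one
  -- degree higher; `D-exponential` then leaves n + j + 1 terms, which suffice in degree n + j.
  compose-derivative : ∀ D → IsDerivation seriesRing D → Local D → (∀ a → D (const a) ≈ˢ const 0#) →
    ∀ h → h 0 0 ≈ 0# → D (compose c h) ≈ˢ compose c h *ˢ D h
  compose-derivative D isDerivation D-local D-const h h₀≈0 n j = begin
    D (compose c h) n j
      ≈⟨ D-local (compose c h) (truncation h h₀≈0 c (2 ℕ.+ (n ℕ.+ j))) (n ℕ.+ j)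
           (λ a b a+b≤ → compose≈truncation h h₀≈0 c (2 ℕ.+ (n ℕ.+ j)) a b (s≤s a+b≤)) n j ℕ.≤-refl ⟩
    D (truncation h h₀≈0 c (2 ℕ.+ (n ℕ.+ j))) n j
      ≈⟨ Derivation.D-exponential seriesRing D isDerivation (λ k → const (c k)) (λ k → D-const (c k))
           const-c-suc h (suc (n ℕ.+ j)) n j ⟩
    (truncation h h₀≈0 c (suc (n ℕ.+ j)) *ˢ D h) n j
      ≈⟨ compose-* h h₀≈0 c (D h) n j ⟩
    (compose c h *ˢ D h) n j
      ∎
    where
    open SemiringMult S.semiring using () renaming (_×_ to _·ˢ_)
    const-c-suc : ∀ k → suc k ·ˢ const (c (suc k)) ≈ˢ const (c k)
    const-c-suc k n j = trans (·ˢ-at (suc k) (const (c (suc k))) n j) (at n j)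
      where
      at : ∀ n j → suc k · const (c (suc k)) n j ≈ const (c k) n j
      at zero    zero    = c-suc k
      at zero    (suc j) = ·-zeroʳ (suc k)
      at (suc n) j       = ·-zeroʳ (suc k)

  UX-*-zero : ∀ f → (U *ˢ X *ˢ f) 0 0 ≈ 0#
  UX-*-zero f = begin
    (U *ˢ X *ˢ f) 0 0       ≈⟨ S.*-cong {U *ˢ X} {X *ˢ U} {f} {f} (S.*-comm U X) (S.refl {f}) 0 0 ⟩
    (X *ˢ U *ˢ f) 0 0       ≈⟨ S.*-assoc X U f 0 0 ⟩
    (X *ˢ (U *ˢ f)) 0 0     ≈⟨ X-*-zero (U *ˢ f) 0 ⟩
    0#                      ∎

  ∂x-exp : ∀ f → ∂x (compose c (U *ˢ X *ˢ f)) ≈ˢ compose c (U *ˢ X *ˢ f) *ˢ ∂x (U *ˢ X *ˢ f)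
  ∂x-exp f = compose-derivative ∂x ∂x-isDerivation ∂x-local ∂x-const (U *ˢ X *ˢ f) (UX-*-zero f)

  ∂y-exp : ∀ f → ∂y (compose c (U *ˢ X *ˢ f)) ≈ˢ compose c (U *ˢ X *ˢ f) *ˢ ∂y (U *ˢ X *ˢ f)
  ∂y-exp f = compose-derivative ∂y ∂y-isDerivation ∂y-local ∂y-const (U *ˢ X *ˢ f) (UX-*-zero f)

  E₁-invariant : Invariant E₁
  E₁-invariant = exp-invariant E₁ (∂x-exp (1ˢ +ˢ Y)) (∂y-exp (1ˢ +ˢ Y))

  E₂-transported : Transported E₂
  E₂-transported = exp-transported E₂ (∂x-exp Y) (∂y-exp Y)

  U-*-at : ∀ f n j → (U *ˢ f) n j ≈ u * f n j
  U-*-at f n j = trans (S.*-cong {U} {const u} {f} {f} U≈const (S.refl {f}) n j) (const-* u f n j)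

  Y-*-∂y : ∀ f n j → (Y *ˢ ∂y f) n j ≈ j · f n j
  Y-*-∂y f n zero    = Y-*-zero (∂y f) n
  Y-*-∂y f n (suc j) = Y-*-suc (∂y f) n j

  X-*-∂x : ∀ f n j → (X *ˢ ∂x f) n j ≈ n · f n j
  X-*-∂x f zero    j = X-*-zero (∂x f) j
  X-*-∂x f (suc n) j = X-*-suc (∂x f) n j

  transport-lhs : ∀ f n j → ((1ˢ +ˢ Y) *ˢ ∂y f) n j ≈ suc j · f n (suc j) + j · f n j
  transport-lhs f n j = trans (S.distribʳ (∂y f) 1ˢ Y n j)
    (+-cong (S.*-identityˡ (∂y f) n j) (Y-*-∂y f n j))

  transport-rhs : ∀ f n j → (X *ˢ ∂x f +ˢ (U *ˢ X) *ˢ f) n j ≈ n · f n j + u * (X *ˢ f) n j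
  transport-rhs f n j = +-cong (X-*-∂x f n j) (trans (S.*-assoc U X f n j) (U-*-at (X *ˢ f) n j))

  X-*-cong-column : ∀ f g j → (∀ n → f n j ≈ g n j) → ∀ n → (X *ˢ f) n j ≈ (X *ˢ g) n j
  X-*-cong-column f g j f≈g zero    = trans (X-*-zero f j) (sym (X-*-zero g j))
  X-*-cong-column f g j f≈g (suc n) = trans (X-*-suc f n j) (trans (f≈g n) (sym (X-*-suc g n j)))

  -- At xⁿyʲ the equation gives (j+1) fₙ,ⱼ₊₁ = (n-j) fₙⱼ + u fₙ₋₁,ⱼ. Since j + 1 is invertible, each
  -- column determines the next.
  transported-unique : ∀ f g → Transported f → Transported g → (∀ n → f n 0 ≈ g n 0) → f ≈ˢ g
  transported-unique f g f-tr g-tr f≈g₀ n j = columns j n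
    where
    columns : ∀ j n → f n j ≈ g n j
    columns zero    n = f≈g₀ n
    columns (suc j) n = suc-·-cancel j (f n (suc j)) (g n (suc j)) (+-cancelʳ (j · f n j) _ _ (begin
      suc j · f n (suc j) + j · f n j     ≈⟨ transport-lhs f n j ⟨
      ((1ˢ +ˢ Y) *ˢ ∂y f) n j             ≈⟨ f-tr n j ⟩
      (X *ˢ ∂x f +ˢ (U *ˢ X) *ˢ f) n j    ≈⟨ transport-rhs f n j ⟩
      n · f n j + u * (X *ˢ f) n j
        ≈⟨ +-cong (×-congʳ n (columns j n)) (*-congˡ (X-*-cong-column f g j (columns j) n)) ⟩
      n · g n j + u * (X *ˢ g) n j        ≈⟨ transport-rhs g n j ⟨
      (X *ˢ ∂x g +ˢ (U *ˢ X) *ˢ g) n j    ≈⟨ g-tr n j ⟨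
      ((1ˢ +ˢ Y) *ˢ ∂y g) n j             ≈⟨ transport-lhs g n j ⟩
      suc j · g n (suc j) + j · g n j     ≈⟨ +-congˡ (×-congʳ j (columns j n)) ⟨
      suc j · g n (suc j) + j · f n j     ∎))

  -- The series A(t, x, y) divided by xy.
  F : Series
  F n j = if j <ᵇ suc n then c j * c (n ∸ j) * B n j else 0#

  F-inside : ∀ j q → F (j ℕ.+ q) j ≈ c j * c q * B (j ℕ.+ q) j
  F-inside j q rewrite <ᵇ-true j q | ℕ.m+n∸m≡n j q = refl

  F-outside : ∀ n j → n ℕ.< j → F n j ≈ 0#
  F-outside n j n<j rewrite <ᵇ-false n j n<j = refl

  -- For j < n the factors j + 1 and n - j are absorbed by the reciprocal factorials, and the
  -- relation `B-suc-suc` remains. For j ≥ n the other terms vanish and the claim is j Fₙⱼ = n Fₙⱼ,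
  -- which holds because j = n or Fₙⱼ = 0.
  F-recurrence : ∀ n j → suc j · F n (suc j) + j · F n j ≈ n · F n j + u * (X *ˢ F) n j
  F-recurrence zero    j = begin
    suc j · 0# + j · F 0 j            ≈⟨ +-cong (·-zeroʳ (suc j)) (row₀ j) ⟩
    0# + 0#                           ≈⟨ +-congˡ (trans (*-congˡ (X-*-zero F j)) (zeroʳ u)) ⟨
    0# + u * (X *ˢ F) 0 j             ∎
    where
    row₀ : ∀ j → j · F 0 j ≈ 0#
    row₀ zero    = refl
    row₀ (suc j) = ·-zeroʳ (suc j)
  F-recurrence (suc m) j =
    trans (by-cases (ℕ.<-≤-connex m j)) (+-congˡ (*-congˡ (sym (X-*-suc F m j))))
    where
    -- Writing m = j + q keeps truncated subtraction out of the computation.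
    inside : ∀ q → suc j · F (suc (j ℕ.+ q)) (suc j) + j · F (suc (j ℕ.+ q)) j
                   ≈ suc (j ℕ.+ q) · F (suc (j ℕ.+ q)) j + u * F (j ℕ.+ q) j
    inside q = begin
      suc j · F (suc (j ℕ.+ q)) (suc j) + j · F′
        ≈⟨ +-congʳ (×-congʳ (suc j) (F-inside (suc j) q)) ⟩
      suc j · (c (suc j) * c q * B′ (suc j)) + j · F′
        ≈⟨ +-congʳ (trans (sym (×-assoc-* (suc j) _ _))
             (*-congʳ (trans (sym (×-assoc-* (suc j) _ _)) (*-congʳ (c-suc j))))) ⟩
      c j * c q * B′ (suc j) + j · F′
        ≈⟨ +-congʳ (*-congˡ (B-suc-suc u t≈1+u (j ℕ.+ q) j (ℕ.m≤m+n j q))) ⟩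
      c j * c q * (B′ j + u * B (j ℕ.+ q) j) + j · F′
        ≈⟨ solve 5 (λ k b u b₀ z → k :* (b :+ u :* b₀) :+ z := z :+ k :* b :+ u :* (k :* b₀))
             refl (c j * c q) (B′ j) u (B (j ℕ.+ q) j) (j · F′) ⟩
      j · F′ + c j * c q * B′ j + u * (c j * c q * B (j ℕ.+ q) j)
        ≈⟨ +-cong (+-congˡ lower) (*-congˡ (F-inside j q)) ⟨
      j · F′ + suc q · F′ + u * F (j ℕ.+ q) j
        ≈⟨ +-congʳ (×-homo-+ F′ j (suc q)) ⟨
      (j ℕ.+ suc q) · F′ + u * F (j ℕ.+ q) j
        ≈⟨ +-congʳ (×-congˡ (ℕ.+-suc j q)) ⟩
      suc (j ℕ.+ q) · F′ + u * F (j ℕ.+ q) j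
        ∎
      where
      F′ = F (suc (j ℕ.+ q)) j
      B′ = B (suc (j ℕ.+ q))
      F′-inside : F′ ≈ c j * c (suc q) * B′ j
      F′-inside = ≡.subst (λ n → F n j ≈ c j * c (suc q) * B n j) (ℕ.+-suc j q) (F-inside j (suc q))
      lower : suc q · F′ ≈ c j * c q * B′ j
      lower = begin
        suc q · F′                               ≈⟨ ×-congʳ (suc q) F′-inside ⟩
        suc q · (c j * c (suc q) * B′ j)         ≈⟨ ×-assoc-* (suc q) _ _ ⟨
        (suc q · (c j * c (suc q))) * B′ j       ≈⟨ *-congʳ (×-comm-* (suc q) (c j) (c (suc q))) ⟨
        c j * (suc q · c (suc q)) * B′ j         ≈⟨ *-congʳ (*-congˡ (c-suc q)) ⟩
        c j * c q * B′ j                         ∎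

    diagonal : suc m ℕ.< j ⊎ suc m ≡ j → suc m · F (suc m) j ≈ j · F (suc m) j
    diagonal (inj₂ ≡.refl) = refl
    diagonal (inj₁ sm<j)   = trans (vanish (suc m)) (sym (vanish j))
      where
      vanish : ∀ k → k · F (suc m) j ≈ 0#
      vanish k = trans (×-congʳ k (F-outside (suc m) j sm<j)) (·-zeroʳ k)

    by-cases : m ℕ.< j ⊎ j ℕ.≤ m →
      suc j · F (suc m) (suc j) + j · F (suc m) j ≈ suc m · F (suc m) j + u * F m j
    by-cases (inj₁ m<j) = begin
      suc j · F (suc m) (suc j) + j · F (suc m) j
        ≈⟨ +-congʳ (trans (×-congʳ (suc j) (F-outside (suc m) (suc j) (s≤s m<j))) (·-zeroʳ (suc j))) ⟩
      0# + j · F (suc m) j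
        ≈⟨ +-comm _ _ ⟩
      j · F (suc m) j + 0#
        ≈⟨ +-cong (diagonal (ℕ.m≤n⇒m<n∨m≡n m<j)) (trans (*-congˡ (F-outside m j m<j)) (zeroʳ u)) ⟨
      suc m · F (suc m) j + u * F m j
        ∎
    by-cases (inj₂ j≤m) =
      ≡.subst (λ m → suc j · F (suc m) (suc j) + j · F (suc m) j ≈ suc m · F (suc m) j + u * F m j)
        (ℕ.m+[n∸m]≡n j≤m) (inside (m ∸ j))

  F-transported : Transported F
  F-transported n j = begin
    ((1ˢ +ˢ Y) *ˢ ∂y F) n j               ≈⟨ transport-lhs F n j ⟩
    suc j · F n (suc j) + j · F n j       ≈⟨ F-recurrence n j ⟩
    n · F n j + u * (X *ˢ F) n j          ≈⟨ transport-rhs F n j ⟨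
    (X *ˢ ∂x F +ˢ (U *ˢ X) *ˢ F) n j      ∎

  open Quotient seriesRing
  open 1D using (_⊛_; _⊕_; ∂; ∂-⊛; ⊛-comm; ⊛-cong; ⊛-scaleˡ; ⊛-distribʳ)

  module 1D-ring = CommutativeRing 1D.seqRing

  -- The column of F at yᵖ, multiplied by p! and divided by xᵖ: by `F-inside`, `c p * row p q` is
  -- the coefficient of F at x^(q+p) yᵖ.
  row : ℕ → 1D.Seq
  row p q = c q * B (q ℕ.+ p) p

  -- Passing from p to p + 1 is the operator d/dx + u: because c q = (q+1) c (q+1), the first term
  -- of `B-suc-suc` becomes a derivative.
  row-suc : ∀ p q → row (suc p) q ≈ ∂ (row p) q + u * row p q
  row-suc p q rewrite ℕ.+-suc q p = begin
    c q * B (suc (q ℕ.+ p)) (suc p)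
      ≈⟨ *-congˡ (B-suc-suc u t≈1+u (q ℕ.+ p) p (ℕ.m≤n+m p q)) ⟩
    c q * (B (suc (q ℕ.+ p)) p + u * B (q ℕ.+ p) p)
      ≈⟨ solve 4 (λ k b u b₀ → k :* (b :+ u :* b₀) := k :* b :+ u :* (k :* b₀))
           refl (c q) (B (suc (q ℕ.+ p)) p) u (B (q ℕ.+ p) p) ⟩
    c q * B (suc (q ℕ.+ p)) p + u * row p q
      ≈⟨ +-congʳ (trans (*-congʳ (sym (c-suc q))) (×-assoc-* (suc q) _ _)) ⟩
    ∂ (row p) q + u * row p q
      ∎

  module _ (e : 1D.Seq) (e-zero : e 0 ≈ 1#) (∂-e : ∀ n → ∂ e n ≈ u * e n) where

    e⊛row-suc : ∀ p q → (e ⊛ row (suc p)) q ≈ ∂ (e ⊛ row p) q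
    e⊛row-suc p q = begin
      (e ⊛ row (suc p)) q
        ≈⟨ ⊛-cong {e} {e} {row (suc p)} {∂ (row p) ⊕ (λ n → u * row p n)} (λ _ → refl) (row-suc p) q ⟩
      (e ⊛ (∂ (row p) ⊕ (λ n → u * row p n))) q
        ≈⟨ 1D-ring.distribˡ e (∂ (row p)) (λ n → u * row p n) q ⟩
      (e ⊛ ∂ (row p)) q + (e ⊛ (λ n → u * row p n)) q
        ≈⟨ +-congˡ (begin
             (e ⊛ (λ n → u * row p n)) q   ≈⟨ ⊛-comm e (λ n → u * row p n) q ⟩
             ((λ n → u * row p n) ⊛ e) q   ≈⟨ ⊛-scaleˡ u (row p) e q ⟩
             u * (row p ⊛ e) q             ≈⟨ *-congˡ (⊛-comm (row p) e q) ⟩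
             u * (e ⊛ row p) q             ≈⟨ ⊛-scaleˡ u e (row p) q ⟨
             ((λ n → u * e n) ⊛ row p) q   ≈⟨ ⊛-cong {∂ e} {λ n → u * e n} {row p} {row p} ∂-e (λ _ → refl) q ⟨
             (∂ e ⊛ row p) q               ∎) ⟩
      (e ⊛ ∂ (row p)) q + (∂ e ⊛ row p) q
        ≈⟨ +-comm _ _ ⟩
      (∂ e ⊛ row p) q + (e ⊛ ∂ (row p)) q
        ≈⟨ ∂-⊛ e (row p) q ⟨
      ∂ (e ⊛ row p) q
        ∎

    -- Multiplication by e conjugates d/dx + u into d/dx, so e ⊛ row p is the
    -- p-th derivative of e ⊛ row 0; its constant term is row p 0.
    e⊛row : ∀ p q → c (q ℕ.+ p) * (e ⊛ row p) q ≈ c q * (e ⊛ row 0) (q ℕ.+ p)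
    e⊛row zero    q =
      reflexive (≡.cong₂ (λ m n → c m * (e ⊛ row 0) n) (ℕ.+-identityʳ q) (≡.sym (ℕ.+-identityʳ q)))
    e⊛row (suc p) q = ≡.subst (λ n → c n * (e ⊛ row (suc p)) q ≈ c q * (e ⊛ row 0) n) (≡.sym (ℕ.+-suc q p)) (begin
      c (suc q ℕ.+ p) * (e ⊛ row (suc p)) q          ≈⟨ *-congˡ (e⊛row-suc p q) ⟩
      c (suc q ℕ.+ p) * (suc q · (e ⊛ row p) (suc q)) ≈⟨ ×-comm-* (suc q) _ _ ⟩
      suc q · (c (suc q ℕ.+ p) * (e ⊛ row p) (suc q)) ≈⟨ ×-congʳ (suc q) (e⊛row p (suc q)) ⟩
      suc q · (c (suc q) * (e ⊛ row 0) (suc q ℕ.+ p)) ≈⟨ ×-assoc-* (suc q) _ _ ⟨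
      (suc q · c (suc q)) * (e ⊛ row 0) (suc q ℕ.+ p) ≈⟨ *-congʳ (c-suc q) ⟩
      c q * (e ⊛ row 0) (suc q ℕ.+ p)                 ∎)

    -- The case q = 0 of `e⊛row`, where the product on the left has the single term `e 0 * row p 0`.
    -- This is how the diagonal of B enters.
    e⊛row-zero : ∀ p → (e ⊛ row 0) p ≈ c p * B p p
    e⊛row-zero p = begin
      (e ⊛ row 0) p                  ≈⟨ *-identityˡ _ ⟨
      1# * (e ⊛ row 0) p             ≈⟨ *-congʳ c-zero ⟨
      c 0 * (e ⊛ row 0) p            ≈⟨ e⊛row p 0 ⟨
      c p * (e 0 * (c 0 * B p p) + 0#)
        ≈⟨ *-congˡ (trans (+-identityʳ _) (trans (*-cong e-zero (trans (*-congʳ c-zero) (*-identityˡ _))) (*-identityˡ _))) ⟩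
      c p * B p p                    ∎

  compose-constant : ∀ h → compose c h 0 0 ≈ 1#
  compose-constant h = trans (+-identityʳ _) (trans (*-identityʳ (c 0)) c-zero)

  [1+Y]-*-at-y⁰ : ∀ f n → ((1ˢ +ˢ Y) *ˢ f) n 0 ≈ f n 0
  [1+Y]-*-at-y⁰ f n = begin
    ((1ˢ +ˢ Y) *ˢ f) n 0               ≈⟨ S.distribʳ f 1ˢ Y n 0 ⟩
    (1ˢ *ˢ f) n 0 + (Y *ˢ f) n 0       ≈⟨ +-cong (S.*-identityˡ f n 0) (Y-*-zero f n) ⟩
    f n 0 + 0#                         ≈⟨ +-identityʳ _ ⟩
    f n 0                              ∎

  ∂x-exp-at : ∀ f → ∂x f ≈ˢ const 0# → ∀ n j →
    suc n · compose c (U *ˢ X *ˢ f) (suc n) j ≈ u * (f *ˢ compose c (U *ˢ X *ˢ f)) n j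
  ∂x-exp-at f ∂xf≈0 n j = begin
    ∂x E n j                           ≈⟨ ∂x-exp f n j ⟩
    (E *ˢ ∂x (U *ˢ X *ˢ f)) n j
      ≈⟨ S.*-cong {E} {E} {∂x (U *ˢ X *ˢ f)} {U *ˢ f} (S.refl {E}) (∂x-UXf f ∂xf≈0) n j ⟩
    (E *ˢ (U *ˢ f)) n j                ≈⟨ S.*-comm E (U *ˢ f) n j ⟩
    (U *ˢ f *ˢ E) n j                  ≈⟨ S.*-assoc U f E n j ⟩
    (U *ˢ (f *ˢ E)) n j                ≈⟨ U-*-at (f *ˢ E) n j ⟩
    u * (f *ˢ E) n j                   ∎
    where E = compose c (U *ˢ X *ˢ f)

  -- The exponential of ux, used through its constant term and its differential equation.
  e : 1D.Seq
  e n = E₁ n 0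

  e-zero : e 0 ≈ 1#
  e-zero = compose-constant (U *ˢ X *ˢ (1ˢ +ˢ Y))

  ∂-e : ∀ n → ∂ e n ≈ u * e n
  ∂-e n = trans (∂x-exp-at (1ˢ +ˢ Y) ∂x-1+Y n 0) (*-congˡ ([1+Y]-*-at-y⁰ E₁ n))

  -- The exponent uxy vanishes at y = 0. Instead of a substitution, the differential equation in x
  -- is used, whose right side carries the factor y.
  E₂-at-y⁰ : ∀ n → E₂ (suc n) 0 ≈ 0#
  E₂-at-y⁰ n = suc-·-cancel n (E₂ (suc n) 0) 0# (begin
    suc n · E₂ (suc n) 0               ≈⟨ ∂x-exp-at Y ∂x-Y n 0 ⟩
    u * (Y *ˢ E₂) n 0                  ≈⟨ trans (*-congˡ (Y-*-zero E₂ n)) (zeroʳ u) ⟩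
    0#                                 ≈⟨ ·-zeroʳ (suc n) ⟨
    suc n · 0#                         ∎)

  F-at-y⁰ : ∀ n → F n 0 ≈ c n * B n 0
  F-at-y⁰ n = trans (*-congʳ (*-congʳ c-zero)) (*-congʳ (*-identityˡ (c n)))

  F*E₁-at-y⁰ : ∀ n → (F *ˢ E₁) n 0 ≈ c n * B n n
  F*E₁-at-y⁰ n = begin
    (F *ˢ E₁) n 0                  ≈⟨ *ˢ-at-y⁰ F E₁ n ⟩
    ((λ m → F m 0) ⊛ e) n          ≈⟨ ⊛-cong {λ m → F m 0} {row 0} {e} {e} F≈row (λ _ → refl) n ⟩
    (row 0 ⊛ e) n                  ≈⟨ ⊛-comm (row 0) e n ⟩
    (e ⊛ row 0) n                  ≈⟨ e⊛row-zero e e-zero ∂-e n ⟩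
    c n * B n n                    ∎
    where
    F≈row : ∀ m → F m 0 ≈ row 0 m
    F≈row m = ≡.subst (λ k → F m 0 ≈ c m * B k 0) (≡.sym (ℕ.+-identityʳ m)) (F-at-y⁰ m)

  T*F≈F*E₁+U*E₂ : T *ˢ F ≈ˢ F *ˢ E₁ +ˢ U *ˢ E₂
  T*F≈F*E₁+U*E₂ = transported-unique (T *ˢ F) (F *ˢ E₁ +ˢ U *ˢ E₂)
    (transported-constant-* T F (∂x-const t) (∂y-const t) F-transported)
    (transported-+ (F *ˢ E₁) (U *ˢ E₂)
      (transported-* F E₁ F-transported E₁-invariant)
      (transported-constant-* U E₂ ∂x-U ∂y-U E₂-transported))
    at-y⁰
    where
    at-y⁰ : ∀ n → (T *ˢ F) n 0 ≈ (F *ˢ E₁ +ˢ U *ˢ E₂) n 0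
    -- Degree 0 is where Bₙₙ = t Bₙ₀ fails, as B₀₀ = 1. The difference t - 1 = u is supplied by
    -- `U *ˢ E₂`, whose y⁰ coefficients vanish in all higher degrees.
    at-y⁰ zero    = begin
      (T *ˢ F) 0 0                      ≈⟨ trans (const-* t F 0 0) (*-congˡ (trans (F-at-y⁰ 0) (trans (*-identityʳ _) c-zero))) ⟩
      t * 1#                            ≈⟨ *-identityʳ t ⟩
      t                                 ≈⟨ t≈1+u ⟩
      1# + u                            ≈⟨ +-cong (trans (*-identityʳ (c 0)) c-zero) (*-identityʳ u) ⟨
      c 0 * B 0 0 + u * 1#              ≈⟨ +-cong (F*E₁-at-y⁰ 0) (trans (U-*-at E₂ 0 0) (*-congˡ (compose-constant (U *ˢ X *ˢ Y)))) ⟨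
      (F *ˢ E₁ +ˢ U *ˢ E₂) 0 0          ∎
    at-y⁰ (suc n) = begin
      (T *ˢ F) (suc n) 0                ≈⟨ trans (const-* t F (suc n) 0) (*-congˡ (F-at-y⁰ (suc n))) ⟩
      t * (c (suc n) * B (suc n) 0)     ≈⟨ solve 3 (λ t k b → t :* (k :* b) := k :* (t :* b) :+ con 0) refl t (c (suc n)) (B (suc n) 0) ⟩
      c (suc n) * (t * B (suc n) 0) + 0# ≈⟨ +-congʳ (*-congˡ (B-last n)) ⟨
      c (suc n) * B (suc n) (suc n) + 0# ≈⟨ +-cong (F*E₁-at-y⁰ (suc n)) (trans (U-*-at E₂ (suc n) 0) (trans (*-congˡ (E₂-at-y⁰ n)) (zeroʳ u))) ⟨
      (F *ˢ E₁ +ˢ U *ˢ E₂) (suc n) 0    ∎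

  F*[T-E₁]≈U*E₂ : F *ˢ (T -ˢ E₁) ≈ˢ U *ˢ E₂
  F*[T-E₁]≈U*E₂ = *-difference F T E₁ (U *ˢ E₂) T*F≈F*E₁+U*E₂

  generatingFunction : ∀ A → (∀ j → A 0 j ≈ 0#) → (∀ n → A (suc n) 0 ≈ 0#) →
    (∀ n j → A (suc n) (suc j) ≈ F n j) → ∀ b → b * (T -ˢ E₁) 0 0 ≈ 1# →
    A ≈ˢ (U *ˢ X *ˢ Y *ˢ E₂) *ˢ
         (const b *ˢ geometric (1ˢ -ˢ const b *ˢ (T -ˢ E₁)))
  generatingFunction A A₀ A₁ A≈F b bg₀≈1 =
    quotient-unique A (const b) (U *ˢ X *ˢ Y *ˢ E₂) (T -ˢ E₁)
      (geometric (1ˢ -ˢ const b *ˢ (T -ˢ E₁)))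
      (geometric-fixpoint (1ˢ -ˢ const b *ˢ (T -ˢ E₁)) (begin
        1# + - (const b *ˢ (T -ˢ E₁)) 0 0    ≈⟨ +-congˡ (-‿cong (trans (const-* b (T -ˢ E₁) 0 0) bg₀≈1)) ⟩
        1# + - 1#                            ≈⟨ -‿inverseʳ 1# ⟩
        0#                                   ∎))
      (shifted-* A F (T -ˢ E₁) E₂ X Y U A≈XYF F*[T-E₁]≈U*E₂)
    where
    A≈XYF : A ≈ˢ X *ˢ (Y *ˢ F)
    A≈XYF zero    j       = trans (A₀ j) (sym (X-*-zero (Y *ˢ F) j))
    A≈XYF (suc n) zero    = trans (A₁ n) (sym (trans (X-*-suc (Y *ˢ F) n 0) (Y-*-zero F n)))
    A≈XYF (suc n) (suc j) =
      trans (A≈F n j) (sym (trans (X-*-suc (Y *ˢ F) n (suc j)) (Y-*-suc F n j)))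

  module Division {p : Level} (NonZero : Carrier → Set p) (inverse : ∀ x → NonZero x → Carrier)
    (inverse-inverseˡ : ∀ x x≢0 → inverse x x≢0 * x ≈ 1#) where

    -- The operations are variables because Agda would decide the definitional
    -- equality of closed series over ℚ(t) by computing their coefficients; for
    -- the same reason the equations are combined by congruence, not matched on.
    generatingFunction′ :
      ∀ {_≈′_ : Series → Series → Set ℓ} {const′ T′ 1′ X′ Y′ _+′_ _-′_ _*′_ exp geometric′}
        {_/_[_] : (f g : Series) → NonZero (g 0 0) → Series} →
      const′ ≡ const → T′ ≡ T → 1′ ≡ 1ˢ → X′ ≡ X → Y′ ≡ Y →
      _+′_ ≡ _+ˢ_ → _-′_ ≡ _-ˢ_ → _*′_ ≡ _*ˢ_ → exp ≡ compose c → geometric′ ≡ geometric →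
      (∀ f g g₀≢0 → f / g [ g₀≢0 ] ≡
        (f *′ (const′ (inverse (g 0 0) g₀≢0) *′
               geometric′ (1′ -′ (const′ (inverse (g 0 0) g₀≢0) *′ g))))) →
      ∀ A → (∀ j → A 0 j ≈ 0#) → (∀ n → A (suc n) 0 ≈ 0#) → (∀ n j → A (suc n) (suc j) ≈ F n j) →
      ∀ g₀≢0 → _≈′_ ≡ _≈ˢ_ →
      A ≈′ (((((T′ -′ 1′) *′ X′) *′ Y′) *′ exp (((T′ -′ 1′) *′ X′) *′ Y′))
            / (T′ -′ exp (((T′ -′ 1′) *′ X′) *′ (1′ +′ Y′))) [ g₀≢0 ])
    generatingFunction′ {_≈′_} {const′} {T′} {1′} {X′} {Y′} {_+′_} {_-′_} {_*′_} {exp} {geometric′} {_/_[_]}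
      const≡ T≡ 1≡ X≡ Y≡ +≡ -≡ *≡ exp≡ geometric≡ /≡ A A₀ A₁ A≈F g₀≢0 ≈≡ =
      ≡.subst (λ _≈_ → A ≈ (numer / denom [ g₀≢0 ])) (≡.sym ≈≡)
        (≡.subst (A ≈ˢ_) (≡.sym quotient≡)
          (generatingFunction A A₀ A₁ A≈F b
            (≡.subst (λ g → b * g 0 0 ≈ 1#) denom≡ (inverse-inverseˡ (denom 0 0) g₀≢0))))
      where
      numer denom : Series
      numer = (((T′ -′ 1′) *′ X′) *′ Y′) *′ exp (((T′ -′ 1′) *′ X′) *′ Y′)
      denom = T′ -′ exp (((T′ -′ 1′) *′ X′) *′ (1′ +′ Y′))

      b : Carrier
      b = inverse (denom 0 0) g₀≢0

      -- The equation between the functions comes last: Agda compares the results as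
      -- soon as the functions are known, unfolding them if the arguments are not.
      apply₁ : ∀ {A : Set r} {f g : A → Series} {x y : A} → x ≡ y → f ≡ g → f x ≡ g y
      apply₁ ≡.refl ≡.refl = ≡.refl

      apply₂ : ∀ {f g : Series → Series → Series} {x y z w : Series} →
        x ≡ y → z ≡ w → f ≡ g → f x z ≡ g y w
      apply₂ ≡.refl ≡.refl ≡.refl = ≡.refl

      U≡ : (T′ -′ 1′) ≡ U
      -- The middle term is pinned so that the closing `refl` only has to unfold `U`.
      U≡ = ≡.trans {j = T -ˢ 1ˢ} (apply₂ T≡ 1≡ -≡) ≡.refl

      UX≡ : ((T′ -′ 1′) *′ X′) ≡ U *ˢ X
      UX≡ = apply₂ U≡ X≡ *≡

      E₁≡ : exp (((T′ -′ 1′) *′ X′) *′ (1′ +′ Y′)) ≡ E₁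
      E₁≡ = ≡.trans {j = compose c (U *ˢ X *ˢ (1ˢ +ˢ Y))}
        (apply₁ (apply₂ UX≡ (apply₂ 1≡ Y≡ +≡) *≡) exp≡) ≡.refl

      E₂≡ : exp (((T′ -′ 1′) *′ X′) *′ Y′) ≡ E₂
      E₂≡ = ≡.trans {j = compose c (U *ˢ X *ˢ Y)} (apply₁ (apply₂ UX≡ Y≡ *≡) exp≡) ≡.refl

      numer≡ : numer ≡ U *ˢ X *ˢ Y *ˢ E₂
      numer≡ = apply₂ (apply₂ UX≡ Y≡ *≡) E₂≡ *≡

      denom≡ : denom ≡ T -ˢ E₁
      denom≡ = apply₂ T≡ E₁≡ -≡

      const-b≡ : const′ b ≡ const b
      const-b≡ = apply₁ ≡.refl const≡

      quotient≡ : (numer / denom [ g₀≢0 ]) ≡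
        (U *ˢ X *ˢ Y *ˢ E₂) *ˢ (const b *ˢ geometric (1ˢ -ˢ const b *ˢ (T -ˢ E₁)))
      quotient≡ = ≡.trans (/≡ numer denom g₀≢0)
        (apply₂ numer≡ (apply₂ const-b≡
          (apply₁ (apply₂ 1≡ (apply₂ const-b≡ denom≡ *≡) -≡) geometric≡) *≡) *≡)

-- The field ℚ(t)

open import Defs

module ℚ[[s]] = Convolution ℚ.+-*-commutativeRing

coeff-* : ∀ p q k → coeff (p *ₚ q) k ≡ (coeff p ℚ[[s]].⊛ coeff q) k
coeff-* []      q k       = ≡.sym (ℚ[[s]].⊛-zeroˡ (coeff []) (coeff q) (λ _ → ≡.refl) k)
coeff-* (c ∷ p) q zero    = ≡.trans (coeff-*-zero c p q) (≡.sym (ℚ.+-identityʳ _))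
coeff-* (c ∷ p) q (suc k) =
  ≡.trans (coeff-*-suc c p q k) (≡.cong (c ℚ.* coeff q (suc k) ℚ.+_) (coeff-* p q k))

coeff-neg : ∀ p k → coeff (-ₚ p) k ≡ ℚ.- coeff p k
coeff-neg []      k       = ≡.refl
coeff-neg (c ∷ p) zero    = ≡.refl
coeff-neg (c ∷ p) (suc k) = coeff-neg p k

poly-rawRing : RawRing 0ℓ 0ℓ
poly-rawRing = record
  { Carrier = ℚ[t] ; _≈_ = _≈ₚ_ ; _+_ = _+ₚ_ ; _*_ = _*ₚ_ ; -_ = -ₚ_ ; 0# = 0ₚ ; 1# = 1ₚ }

-- Polynomials are compared by their coefficients, so injectivity is immediate, and the ring axioms
-- descend from power series over ℚ.
coeff-isRingMonomorphism : IsRingMonomorphism poly-rawRing ℚ[[s]].seq-rawRing coeff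
coeff-isRingMonomorphism = record
  { isRingHomomorphism = record
    { isSemiringHomomorphism = record
      { isNearSemiringHomomorphism = record
        { +-isMonoidHomomorphism = record
          { isMagmaHomomorphism = record
            { isRelHomomorphism = record { cong = λ p≈q → p≈q }
            ; homo = coeff-+
            }
          ; ε-homo = λ _ → ≡.refl
          }
        ; *-homo = coeff-*
        }
      ; 1#-homo = λ { zero → ≡.refl ; (suc _) → ≡.refl }
      }
    ; -‿homo = coeff-neg
    }
  ; injective = λ p≈q → p≈q
  }

abstract
  polyRing-isCommutativeRing : IsCommutativeRing _≈ₚ_ _+ₚ_ _*ₚ_ -ₚ_ 0ₚ 1ₚ
  polyRing-isCommutativeRing = RingMonomorphism.isCommutativeRing coeff-isRingMonomorphism
    (CommutativeRing.isCommutativeRing ℚ[[s]].seqRing)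

polyRing : CommutativeRing 0ℓ 0ℓ
polyRing = record { isCommutativeRing = polyRing-isCommutativeRing }

-- Laws of fractions in cross-multiplied form

module Cross {c ℓ : Level} (P : CommutativeRing c ℓ) where

  open CommutativeRing P
  open RingProperties ring
  open RingSolver commutativeSemiring using (solve; _:=_; _:+_; _:*_; con)
  open SetoidReasoning setoid

  Cancellable : Carrier → Set (c ⊔ ℓ)
  Cancellable s = ∀ x y → s * x ≈ s * y → x ≈ y

  -- Transitivity is the one law here that cancels, namely the middle denominator `s`.
  cross-trans : ∀ p q r s v w → Cancellable s → p * s ≈ r * q → r * w ≈ v * s → p * w ≈ v * q
  cross-trans p q r s v w s-cancel ps≈rq rw≈vs = s-cancel _ _ (begin
    s * (p * w)  ≈⟨ solve 3 (λ s p w → s :* (p :* w) := (p :* s) :* w) refl s p w ⟩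
    (p * s) * w  ≈⟨ *-congʳ ps≈rq ⟩
    (r * q) * w  ≈⟨ solve 3 (λ r q w → (r :* q) :* w := (r :* w) :* q) refl r q w ⟩
    (r * w) * q  ≈⟨ *-congʳ rw≈vs ⟩
    (v * s) * q  ≈⟨ solve 3 (λ v s q → (v :* s) :* q := s :* (v :* q)) refl v s q ⟩
    s * (v * q)  ∎)

  cross-+-cong : ∀ p q p′ q′ r s r′ s′ → p * q′ ≈ p′ * q → r * s′ ≈ r′ * s →
    (p * s + r * q) * (q′ * s′) ≈ (p′ * s′ + r′ * q′) * (q * s)
  cross-+-cong p q p′ q′ r s r′ s′ eq₁ eq₂ = begin
    (p * s + r * q) * (q′ * s′)
      ≈⟨ solve 6 (λ p q r s q′ s′ → (p :* s :+ r :* q) :* (q′ :* s′) :=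
           (p :* q′) :* (s :* s′) :+ (r :* s′) :* (q :* q′)) refl p q r s q′ s′ ⟩
    (p * q′) * (s * s′) + (r * s′) * (q * q′)
      ≈⟨ +-cong (*-congʳ eq₁) (*-congʳ eq₂) ⟩
    (p′ * q) * (s * s′) + (r′ * s) * (q * q′)
      ≈⟨ solve 6 (λ p′ q r′ s q′ s′ → (p′ :* q) :* (s :* s′) :+ (r′ :* s) :* (q :* q′) :=
           (p′ :* s′ :+ r′ :* q′) :* (q :* s)) refl p′ q r′ s q′ s′ ⟩
    (p′ * s′ + r′ * q′) * (q * s)
      ∎

  cross-*-cong : ∀ p q p′ q′ r s r′ s′ → p * q′ ≈ p′ * q → r * s′ ≈ r′ * s →
    (p * r) * (q′ * s′) ≈ (p′ * r′) * (q * s)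
  cross-*-cong p q p′ q′ r s r′ s′ eq₁ eq₂ = begin
    (p * r) * (q′ * s′)  ≈⟨ solve 4 (λ p r q s → (p :* r) :* (q :* s) := (p :* q) :* (r :* s)) refl p r q′ s′ ⟩
    (p * q′) * (r * s′)  ≈⟨ *-cong eq₁ eq₂ ⟩
    (p′ * q) * (r′ * s)  ≈⟨ solve 4 (λ p r q s → (p :* q) :* (r :* s) := (p :* r) :* (q :* s)) refl p′ r′ q s ⟩
    (p′ * r′) * (q * s)  ∎

  cross-neg-cong : ∀ p q p′ q′ → p * q′ ≈ p′ * q → - p * q′ ≈ - p′ * q
  cross-neg-cong p q p′ q′ eq = begin
    - p * q′    ≈⟨ -‿distribˡ-* p q′ ⟨
    - (p * q′)  ≈⟨ -‿cong eq ⟩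
    - (p′ * q)  ≈⟨ -‿distribˡ-* p′ q ⟩
    - p′ * q    ∎

  cross-+-assoc : ∀ p q r s v w →
    ((p * s + r * q) * w + v * (q * s)) * (q * (s * w)) ≈ (p * (s * w) + (r * w + v * s) * q) * ((q * s) * w)
  cross-+-assoc p q r s v w = solve 6 (λ p q r s v w →
    ((p :* s :+ r :* q) :* w :+ v :* (q :* s)) :* (q :* (s :* w)) :=
    (p :* (s :* w) :+ (r :* w :+ v :* s) :* q) :* ((q :* s) :* w)) refl p q r s v w

  cross-+-comm : ∀ p q r s → (p * s + r * q) * (s * q) ≈ (r * q + p * s) * (q * s)
  cross-+-comm p q r s = solve 4 (λ p q r s →
    (p :* s :+ r :* q) :* (s :* q) := (r :* q :+ p :* s) :* (q :* s)) refl p q r s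

  cross-+-identityˡ : ∀ p q → (0# * q + p * 1#) * q ≈ p * (1# * q)
  cross-+-identityˡ p q = solve 2 (λ p q →
    (con 0 :* q :+ p :* con 1) :* q := p :* (con 1 :* q)) refl p q

  cross-inverseˡ : ∀ p q → (- p * q + p * q) * 1# ≈ 0# * (q * q)
  cross-inverseˡ p q = begin
    (- p * q + p * q) * 1#    ≈⟨ *-identityʳ _ ⟩
    - p * q + p * q           ≈⟨ +-congʳ (-‿distribˡ-* p q) ⟨
    - (p * q) + p * q         ≈⟨ -‿inverseˡ (p * q) ⟩
    0#                        ≈⟨ zeroˡ (q * q) ⟨
    0# * (q * q)              ∎

  cross-*-assoc : ∀ p q r s v w → ((p * r) * v) * (q * (s * w)) ≈ (p * (r * v)) * ((q * s) * w)
  cross-*-assoc p q r s v w = *-cong (*-assoc p r v) (sym (*-assoc q s w))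

  cross-distribˡ : ∀ p q r s v w →
    (p * (r * w + v * s)) * ((q * s) * (q * w)) ≈ ((p * r) * (q * w) + (p * v) * (q * s)) * (q * (s * w))
  cross-distribˡ p q r s v w = solve 6 (λ p q r s v w →
    (p :* (r :* w :+ v :* s)) :* ((q :* s) :* (q :* w)) :=
    ((p :* r) :* (q :* w) :+ (p :* v) :* (q :* s)) :* (q :* (s :* w))) refl p q r s v w

module ℚ[t]-ring where
  open CommutativeRing polyRing public
  open Cross polyRing public
  open RingProperties ring public
  open SetoidReasoning setoid

  -- The product s(x - y) is zero, and there are no zero divisors.
  nonzero⇒cancellable : ∀ s → s ≉ₚ 0ₚ → Cancellable s
  nonzero⇒cancellable s s≉0 x y sx≈sy with *ₚ-noZeroDivisors s (x +ₚ (-ₚ y)) (begin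
    s *ₚ (x +ₚ (-ₚ y))            ≈⟨ distribˡ s x (-ₚ y) ⟩
    s *ₚ x +ₚ s *ₚ (-ₚ y)         ≈⟨ +-cong {s *ₚ x} {s *ₚ y} {s *ₚ (-ₚ y)} { -ₚ (s *ₚ y)} sx≈sy (sym { -ₚ (s *ₚ y)} {s *ₚ (-ₚ y)} (-‿distribʳ-* s y)) ⟩
    s *ₚ y +ₚ (-ₚ (s *ₚ y))       ≈⟨ -‿inverseʳ (s *ₚ y) ⟩
    0ₚ                            ∎)
  ... | inj₁ s≈0   = contradiction s≈0 s≉0
  ... | inj₂ x-y≈0 = x∙y⁻¹≈ε⇒x≈y x y x-y≈0

ℚ⟨t⟩-ring : CommutativeRing 0ℓ 0ℓ
ℚ⟨t⟩-ring = record
  { RawRing ℚ⟨t⟩-rawRing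
  ; isCommutativeRing = record
    { isRing = record
      { +-isAbelianGroup = record
        { isGroup = record
          { isMonoid = record
            { isSemigroup = record
              { isMagma = record
                { isEquivalence = record
                  { refl  = λ {f} → refl {num f *ₚ den f}
                  ; sym   = λ {f} {g} → sym {num f *ₚ den g} {num g *ₚ den f}
                  ; trans = λ {f} {g} {h} → cross-trans (num f) (den f) (num g) (den g) (num h) (den h)
                              (nonzero⇒cancellable (den g) (den≉0 g))
                  }
                ; ∙-cong = λ {f} {f′} {g} {g′} →
                    cross-+-cong (num f) (den f) (num f′) (den f′) (num g) (den g) (num g′) (den g′)
                }
              ; assoc = λ f g h → cross-+-assoc (num f) (den f) (num g) (den g) (num h) (den h)
              }
            ; identity = +-idˡ , (λ f → trans′ (f K.+ K.0#) (K.0# K.+ f) f (+-comm′ f K.0#) (+-idˡ f))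
            }
          ; inverse = +-invˡ , (λ f → trans′ (f K.+ K.- f) (K.- f K.+ f) K.0# (+-comm′ f (K.- f)) (+-invˡ f))
          ; ⁻¹-cong = λ {f} {g} → cross-neg-cong (num f) (den f) (num g) (den g)
          }
        ; comm = +-comm′
        }
      ; *-cong = λ {f} {f′} {g} {g′} →
          cross-*-cong (num f) (den f) (num f′) (den f′) (num g) (den g) (num g′) (den g′)
      ; *-assoc = λ f g h → cross-*-assoc (num f) (den f) (num g) (den g) (num h) (den h)
      ; *-identity = *-idˡ , (λ f → trans′ (f K.* K.1#) (K.1# K.* f) f (*-comm′ f K.1#) (*-idˡ f))
      ; distrib = distˡ , λ f g h →
          trans′ ((g K.+ h) K.* f) (f K.* (g K.+ h)) (g K.* f K.+ h K.* f)
            (*-comm′ (g K.+ h) f)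
            (trans′ (f K.* (g K.+ h)) (f K.* g K.+ f K.* h) (g K.* f K.+ h K.* f) (distˡ f g h)
              (+-cong′ (f K.* g) (g K.* f) (f K.* h) (h K.* f) (*-comm′ f g) (*-comm′ f h)))
      }
    ; *-comm = *-comm′
    }
  }
  where
  open ℚ[t]-ring
  open ℚ⟨t⟩
  -- Fractions are passed explicitly, since `K._≈_` unfolds to an equation of polynomials from which
  -- they cannot be inferred.
  trans′ : ∀ f g h → f K.≈ g → g K.≈ h → f K.≈ h
  trans′ f g h = cross-trans (num f) (den f) (num g) (den g) (num h) (den h)
    (nonzero⇒cancellable (den g) (den≉0 g))
  +-cong′ : ∀ f f′ g g′ → f K.≈ f′ → g K.≈ g′ → f K.+ g K.≈ f′ K.+ g′
  +-cong′ f f′ g g′ = cross-+-cong (num f) (den f) (num f′) (den f′) (num g) (den g) (num g′) (den g′)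
  +-comm′ : ∀ f g → f K.+ g K.≈ g K.+ f
  +-comm′ f g = cross-+-comm (num f) (den f) (num g) (den g)
  +-idˡ : ∀ f → K.0# K.+ f K.≈ f
  +-idˡ f = cross-+-identityˡ (num f) (den f)
  +-invˡ : ∀ f → (K.- f) K.+ f K.≈ K.0#
  +-invˡ f = cross-inverseˡ (num f) (den f)
  *-comm′ : ∀ f g → f K.* g K.≈ g K.* f
  *-comm′ f g = *-cong {num f *ₚ num g} {num g *ₚ num f} {den g *ₚ den f} {den f *ₚ den g}
    (*-comm (num f) (num g)) (*-comm (den g) (den f))
  *-idˡ : ∀ f → K.1# K.* f K.≈ f
  *-idˡ f = *-cong {1ₚ *ₚ num f} {num f} {den f} {1ₚ *ₚ den f}
    (*-identityˡ (num f)) (sym {1ₚ *ₚ den f} {den f} (*-identityˡ (den f)))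
  distˡ : ∀ f g h → f K.* (g K.+ h) K.≈ f K.* g K.+ f K.* h
  distˡ f g h = cross-distribˡ (num f) (den f) (num g) (den g) (num h) (den h)

inv-inverseˡ : ∀ f f≉0 → inv f f≉0 K.* f K.≈ K.1#
inv-inverseˡ (p // q ⟨ _ ⟩) f≉0 = trans {(q *ₚ p) *ₚ 1ₚ} {(p *ₚ q) *ₚ 1ₚ} {1ₚ *ₚ (p *ₚ q)}
  (*-cong {q *ₚ p} {p *ₚ q} {1ₚ} {1ₚ} (*-comm q p) (refl {1ₚ})) (*-comm (p *ₚ q) 1ₚ)
  where open ℚ[t]-ring

-- Rational weights and their images in ℚ(t)

fromℚᵘ-+ : ∀ p q → fromℚᵘ p ℚ.+ fromℚᵘ q ≡ fromℚᵘ (p ℚᵘ.+ q)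
fromℚᵘ-+ p q = ℚ.toℚᵘ-injective (begin
  toℚᵘ (fromℚᵘ p ℚ.+ fromℚᵘ q)            ≈⟨ ℚ.toℚᵘ-homo-+ (fromℚᵘ p) (fromℚᵘ q) ⟩
  toℚᵘ (fromℚᵘ p) ℚᵘ.+ toℚᵘ (fromℚᵘ q)    ≈⟨ ℚᵘ.+-cong (ℚ.toℚᵘ-fromℚᵘ p) (ℚ.toℚᵘ-fromℚᵘ q) ⟩
  p ℚᵘ.+ q                                ≈⟨ ℚ.toℚᵘ-fromℚᵘ (p ℚᵘ.+ q) ⟨
  toℚᵘ (fromℚᵘ (p ℚᵘ.+ q))                ∎)
  where open ℚᵘ.≃-Reasoning

fromℚᵘ-* : ∀ p q → fromℚᵘ p ℚ.* fromℚᵘ q ≡ fromℚᵘ (p ℚᵘ.* q)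
fromℚᵘ-* p q = ℚ.toℚᵘ-injective (begin
  toℚᵘ (fromℚᵘ p ℚ.* fromℚᵘ q)            ≈⟨ ℚ.toℚᵘ-homo-* (fromℚᵘ p) (fromℚᵘ q) ⟩
  toℚᵘ (fromℚᵘ p) ℚᵘ.* toℚᵘ (fromℚᵘ q)    ≈⟨ ℚᵘ.*-cong (ℚ.toℚᵘ-fromℚᵘ p) (ℚ.toℚᵘ-fromℚᵘ q) ⟩
  p ℚᵘ.* q                                ≈⟨ ℚ.toℚᵘ-fromℚᵘ (p ℚᵘ.* q) ⟨
  toℚᵘ (fromℚᵘ (p ℚᵘ.* q))                ∎)
  where open ℚᵘ.≃-Reasoning

/-cross : ∀ a b c d .{{_ : ℕ.NonZero b}} .{{_ : ℕ.NonZero d}} →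
  a ℕ.* d ≡ c ℕ.* b → + a ℚ./ b ≡ + c ℚ./ d
/-cross a (suc b) c (suc d) ad≡cb = ℚ.fromℚᵘ-cong {mkℚᵘ (+ a) b} {mkℚᵘ (+ c) d}
  (*≡* (≡.trans (≡.sym (ℤ.pos-* a (suc d))) (≡.trans (≡.cong +_ ad≡cb) (ℤ.pos-* c (suc b)))))

/-* : ∀ a b c d .{{_ : ℕ.NonZero b}} .{{_ : ℕ.NonZero d}} .{{_ : ℕ.NonZero (b ℕ.* d)}} →
  (+ a ℚ./ b) ℚ.* (+ c ℚ./ d) ≡ + (a ℕ.* c) ℚ./ (b ℕ.* d)
/-* a (suc b) c (suc d) = ≡.trans (fromℚᵘ-* (mkℚᵘ (+ a) b) (mkℚᵘ (+ c) d))
  (≡.cong (λ z → z ℚ./ (suc b ℕ.* suc d)) (≡.sym (ℤ.pos-* a c)))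

suc/1 : ∀ n → + suc n ℚ./ 1 ≡ 1ℚ ℚ.+ (+ n ℚ./ 1)
suc/1 n = ≡.sym (≡.trans (fromℚᵘ-+ (mkℚᵘ (+ 1) 0) (mkℚᵘ (+ n) 0))
  (≡.cong (λ z → (+ 1 ℤ.+ z) ℚ./ 1) (ℤ.*-identityʳ (+ n))))

module ι-properties where

  open SemiringMult (CommutativeRing.semiring ℚ⟨t⟩-ring) renaming (_×_ to _·_)
  private
    module P = CommutativeRing polyRing
    module K′ = CommutativeRing ℚ⟨t⟩-ring
  open SetoidReasoning K′.setoid

  fromPoly-+ : ∀ p q → fromPoly (p +ₚ q) K.≈ fromPoly p K.+ fromPoly q
  fromPoly-+ p q = P.*-cong {p +ₚ q} {p *ₚ 1ₚ +ₚ q *ₚ 1ₚ} {1ₚ *ₚ 1ₚ} {1ₚ}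
    (P.+-cong {p} {p *ₚ 1ₚ} {q} {q *ₚ 1ₚ} (p≈p*1 p) (p≈p*1 q)) (P.*-identityˡ 1ₚ)
    where
    p≈p*1 : ∀ p → p ≈ₚ p *ₚ 1ₚ
    p≈p*1 p = P.sym {p *ₚ 1ₚ} {p} (P.*-identityʳ p)

  fromPoly-* : ∀ p q → fromPoly (p *ₚ q) K.≈ fromPoly p K.* fromPoly q
  fromPoly-* p q = P.*-cong {p *ₚ q} {p *ₚ q} {1ₚ *ₚ 1ₚ} {1ₚ} (P.refl {p *ₚ q}) (P.*-identityˡ 1ₚ)

  fromPoly-cong : ∀ p q → p ≈ₚ q → fromPoly p K.≈ fromPoly q
  fromPoly-cong p q p≈q = P.*-cong {p} {q} {1ₚ} {1ₚ} p≈q (P.refl {1ₚ})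

  ι-+ : ∀ a b → ι (a ℚ.+ b) K.≈ ι a K.+ ι b
  ι-+ a b = fromPoly-+ (a ∷ []) (b ∷ [])

  ι-* : ∀ a b → ι (a ℚ.* b) K.≈ ι a K.* ι b
  ι-* a b = K′.trans {ι (a ℚ.* b)} {fromPoly ((a ∷ []) *ₚ (b ∷ []))} {ι a K.* ι b}
    (fromPoly-cong (a ℚ.* b ∷ []) ((a ∷ []) *ₚ (b ∷ [])) λ { zero → ≡.sym (ℚ.+-identityʳ (a ℚ.* b)) ; (suc _) → ≡.refl })
    (fromPoly-* (a ∷ []) (b ∷ []))

  ι-cong : ∀ {a b} → a ≡ b → ι a K.≈ ι b
  ι-cong {a} ≡.refl = K′.refl {ι a}

  ι-0 : ι 0ℚ K.≈ K.0#
  ι-0 = fromPoly-cong (0ℚ ∷ []) [] λ { zero → ≡.refl ; (suc _) → ≡.refl }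

  -- Connects multiplication by the rational n/1 with the n-fold sum that stands for it over an
  -- arbitrary ring.
  ι-· : ∀ n q → ι ((+ n ℚ./ 1) ℚ.* q) K.≈ n · ι q
  ι-· zero    q = begin
    ι (0ℚ ℚ.* q)  ≈⟨ ι-cong (ℚ.*-zeroˡ q) ⟩
    ι 0ℚ          ≈⟨ ι-0 ⟩
    K.0#          ∎
  ι-· (suc n) q = begin
    ι ((+ suc n ℚ./ 1) ℚ.* q)            ≈⟨ ι-cong (≡.cong (ℚ._* q) (suc/1 n)) ⟩
    ι ((1ℚ ℚ.+ (+ n ℚ./ 1)) ℚ.* q)       ≈⟨ ι-cong (ℚ.*-distribʳ-+ q 1ℚ (+ n ℚ./ 1)) ⟩
    ι (1ℚ ℚ.* q ℚ.+ (+ n ℚ./ 1) ℚ.* q)   ≈⟨ ι-+ (1ℚ ℚ.* q) ((+ n ℚ./ 1) ℚ.* q) ⟩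
    ι (1ℚ ℚ.* q) K.+ ι ((+ n ℚ./ 1) ℚ.* q)
      ≈⟨ K′.+-cong {ι (1ℚ ℚ.* q)} {ι q} {ι ((+ n ℚ./ 1) ℚ.* q)} {n · ι q}
           (ι-cong (ℚ.*-identityˡ q)) (ι-· n q) ⟩
    ι q K.+ n · ι q                      ∎

  ι-1/!-suc : ∀ k → suc k · ι (1/ suc k !) K.≈ ι (1/ k !)
  ι-1/!-suc k = begin
    suc k · ι (1/ suc k !)                ≈⟨ ι-· (suc k) (1/ suc k !) ⟨
    ι ((+ suc k ℚ./ 1) ℚ.* 1/ suc k !)    ≈⟨ ι-cong (≡.trans (/-* (suc k) 1 1 (suc k !)) (/-cross (suc k ℕ.* 1) (1 ℕ.* suc k !) 1 (k !) eq)) ⟩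
    ι (1/ k !)                            ∎
    where
    instance _ = k ℕ.!≢0
    instance _ = suc k ℕ.!≢0
    instance _ = ℕ.m*n≢0 1 (suc k !)
    eq : suc k ℕ.* 1 ℕ.* k ! ≡ 1 ℕ.* (1 ℕ.* suc k !)
    eq = ≡.trans (≡.cong (ℕ._* k !) (ℕ.*-identityʳ (suc k)))
      (≡.sym (≡.trans (ℕ.*-identityˡ (1 ℕ.* suc k !)) (ℕ.*-identityˡ (suc k !))))

  -- Brings a weight of `Aˢ` into the form that `sum-scale` expects: a count times a factor
  -- independent of d.
  ι-/! : ∀ m p q → ι ((+ m ℚ./ (p ! ℕ.* q !)) {{p ℕ.!* q !≢0}}) K.≈ m · (ι (1/ p !) K.* ι (1/ q !))
  ι-/! m p q = begin
    ι (+ m ℚ./ (p ! ℕ.* q !))                        ≈⟨ ι-cong eq ⟩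
    ι ((+ m ℚ./ 1) ℚ.* (1/ p ! ℚ.* 1/ q !))          ≈⟨ ι-· m (1/ p ! ℚ.* 1/ q !) ⟩
    m · ι (1/ p ! ℚ.* 1/ q !)
      ≈⟨ ×-congʳ m {ι (1/ p ! ℚ.* 1/ q !)} {ι (1/ p !) K.* ι (1/ q !)} (ι-* (1/ p !) (1/ q !)) ⟩
    m · (ι (1/ p !) K.* ι (1/ q !))                  ∎
    where
    instance _ = p ℕ.!≢0
    instance _ = q ℕ.!≢0
    instance _ = p ℕ.!* q !≢0
    instance _ = ℕ.m*n≢0 1 (p ! ℕ.* q !)
    eq : + m ℚ./ (p ! ℕ.* q !) ≡ (+ m ℚ./ 1) ℚ.* (1/ p ! ℚ.* 1/ q !)
    eq = ≡.sym (≡.trans (≡.cong ((+ m ℚ./ 1) ℚ.*_) (/-* 1 (p !) 1 (q !)))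
      (≡.trans (/-* m 1 1 (p ! ℕ.* q !))
        (/-cross (m ℕ.* 1) (1 ℕ.* (p ! ℕ.* q !)) m (p ! ℕ.* q !)
          (≡.trans (≡.cong (ℕ._* (p ! ℕ.* q !)) (ℕ.*-identityʳ m))
            (≡.cong (m ℕ.*_) (≡.sym (ℕ.*-identityˡ (p ! ℕ.* q !))))))))

-- Specialisation to ℚ(t)

module K′ = CommutativeRing ℚ⟨t⟩-ring
open ι-properties

1/!-isReciprocalFactorial : IsReciprocalFactorial ℚ⟨t⟩-ring (λ k → ι (1/ k !))
1/!-isReciprocalFactorial = record { c-zero = K′.refl {K.1#} ; c-suc = ι-1/!-suc }

open GeneratingFunction ℚ⟨t⟩-ring t (λ k → ι (1/ k !)) 1/!-isReciprocalFactorial using (F; module Division)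
open Division (K._≉ K.0#) inv inv-inverseˡ using (generatingFunction′)
open DescentPolynomials ℚ⟨t⟩-ring t using (B; sum-A)
open FiniteSum ℚ⟨t⟩-ring using (sum-scale; if-cong)

Aˢ-zero : ∀ j → Aˢ 0 j K.≈ K.0#
Aˢ-zero zero    = K′.refl {K.0#}
Aˢ-zero (suc j) = K′.refl {K.0#}

Aˢ-suc : ∀ n j → Aˢ (suc n) (suc j) K.≈ F n j
-- With both indices shifted by one, the test 1 ≤ j + 1 ≤ n + 1 reduces to `j <ᵇ suc n`, the test in
-- `F`.
Aˢ-suc n j = if-cong (j <ᵇ suc n) (K.sum {suc n} λ d → weight (toℕ d) K.* t K.^ toℕ d) (s K.* B n j)
  λ j<ᵇ1+n → K′.trans {K.sum {suc n} λ d → weight (toℕ d) K.* t K.^ toℕ d} {s K.* sum′} {s K.* B n j}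
    (sum-scale (suc n) s (λ d → A (suc n) (toℕ d) (suc j)) (λ d → weight (toℕ d)) (λ d → t K.^ toℕ d)
      λ d → ι-/! (A (suc n) (toℕ d) (suc j)) j (n ∸ j))
    (K′.*-congˡ {s} {sum′} {B n j}
      (sum-A n j (ℕ.s≤s⁻¹ (ℕ.<ᵇ⇒< j (suc n) (≡.subst Bool.T (≡.sym j<ᵇ1+n) tt)))))
    where
    open SemiringMult K′.semiring using () renaming (_×_ to _·_)
    weight : ℕ → ℚ⟨t⟩
    weight d = ι ((+ A (suc n) d (suc j) ℚ./ (j ! ℕ.* (n ∸ j) !)) {{j ℕ.!* (n ∸ j) !≢0}})
    s sum′ : ℚ⟨t⟩
    s = ι (1/ j !) K.* ι (1/ (n ∸ j) !)
    sum′ = K.sum {suc n} λ d → A (suc n) (toℕ d) (suc j) · t K.^ toℕ d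

K-rawRing : RawRing _ _
K-rawRing = Ring.rawRing K′.ring

-- These equations have signatures of their own because Agda unfolds _≈ˢ_, X, _*ˢ_, ...
-- to their definitions in PowerSeries when they occur in a term, and then no longer
-- recognises the type of the theorem without computing.

≈≡ : _≈ˢ_ ≡ PowerSeries._≈ˢ_ K-rawRing
≈≡ = ≡.refl

T≡ : T ≡ PowerSeries.const K-rawRing t
T≡ = ≡.refl

1≡ : 1ˢ ≡ PowerSeries.1ˢ K-rawRing
1≡ = ≡.refl

X≡ : X ≡ PowerSeries.X K-rawRing
X≡ = ≡.refl

Y≡ : Y ≡ PowerSeries.Y K-rawRing
Y≡ = ≡.refl

+≡ : _+ˢ_ ≡ PowerSeries._+ˢ_ K-rawRing
+≡ = ≡.refl

-≡ : _-ˢ_ ≡ PowerSeries._-ˢ_ K-rawRing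
-≡ = ≡.refl

*≡ : _*ˢ_ ≡ PowerSeries._*ˢ_ K-rawRing
*≡ = ≡.refl

exp≡ : exp ≡ PowerSeries.compose K-rawRing (λ k → ι (1/ k !))
exp≡ = ≡.refl

geometric : Series → Series
geometric h = compose (λ _ → K.1#) h

geometric≡ : geometric ≡ SeriesRing.geometric ℚ⟨t⟩-ring
geometric≡ = ≡.refl

const≡ : const ≡ PowerSeries.const K-rawRing
const≡ = ≡.refl

/≡ : ∀ f g g₀≉0 → f /ˢ g [ g₀≉0 ] ≡
  f *ˢ (const (inv (g 0 0) g₀≉0) *ˢ geometric (1ˢ -ˢ const (inv (g 0 0) g₀≉0) *ˢ g))
/≡ f g g₀≉0 = ≡.refl

theorem2p2 : Aˢ ≈ˢ ((T -ˢ 1ˢ) *ˢ X *ˢ Y *ˢ exp ((T -ˢ 1ˢ) *ˢ X *ˢ Y))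
    /ˢ (T -ˢ exp ((T -ˢ 1ˢ) *ˢ X *ˢ (1ˢ +ˢ Y))) [ denominator₀≉0 ]
theorem2p2 = generatingFunction′ const≡ T≡ 1≡ X≡ Y≡ +≡ -≡ *≡ exp≡ geometric≡ /≡
  Aˢ Aˢ-zero (λ n → K′.refl {K.0#}) Aˢ-suc denominator₀≉0 ≈≡
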